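{- Let $G$ be a preg system. Then there exist a preg system $G'$ with $G\sqsubseteq G'$ (whose signature contains $\Sigma_{FTP}$) and a finite axiom system $E_{G'}$ such that (1) $E_{G'}$ is sound for bisimilarity on $T(\Sigma_{G'})$, and (2) $E_{G'}$ is head normalizing for $T(\Sigma_{G'})$: every $t\in T(\Sigma_{G'})$ is provably equal from $E_{G'}$ to a term in head normal form. Moreover, $G'$ and $E_{G'}$ can be effectively constructed from $G$.
   Context: Fix finite nonempty actions $\mathcal{A}$ and finite predicates $\mathcal{P}$. A preg transition rule for $l$-ary $f$ has premises $\{x_i\xrightarrow{a_{ij}}y_{ij}\}_{i\in I^+,j\in J_i}$, $\{P_{ij}x_i\}_{i\in J^+,j\in K_i}$, $\{x_i\not\xrightarrow{b}\}_{i\in I^-,b\in\mathcal{B}_i}$, $\{\neg Qx_i\}_{i\in J^-,Q\in\mathcal{Q}_i}$ and conclusion $f(x_1,\dots,x_l)\xrightarrow{c}C[\vec x,\vec y]$ (pairwise distinct variables, $I^\pm,J^\pm\subseteq\{1,\dots,l\}$, finite index sets, $C$ a term in at most these variables); a preg predicate rule has the same premises and conclusion $P(f(x_1,\dots,x_l))$. A preg system is a finite signature with a finite set of preg rules; its transitions and predicates on closed terms are defined by induction: $f(\vec t)\xrightarrow{c}C\sigma$ (resp. $P(f(\vec t))$) iff some rule for $f$ with that conclusion has all premises satisfied (positive ones hold, negative ones fail) by a closed substitution $\sigma$ with $\sigma(x_i)=t_i$. Bisimilarity $\sim$: largest symmetric relation on closed terms whose pairs match each other's transitions into related pairs and satisfy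 the same predicates. $G\sqsubseteq G'$: $G'$ contains $G$'s signature and rules and adds no rules whose principal operation is in $G$. $\Sigma_{FTP}$ consists of constant $\delta$, constants $\kappa_P$ ($P\in\mathcal{P}$), prefixes $a.\_$ ($a\in\mathcal{A}$) and binary $+$, with the rules $a.x\xrightarrow{a}x$; $x\xrightarrow{a}x'\Rightarrow x+y\xrightarrow{a}x'$; $y\xrightarrow{a}y'\Rightarrow x+y\xrightarrow{a}y'$; $P\kappa_P$; $Px\Rightarrow P(x+y)$; $Py\Rightarrow P(x+y)$ (possibly together with rules $Px\Rightarrow P(a.x)$ for designated implicit predicates). A term is in head normal form if it is $\sum_{i\in I}a_i.t_i+\sum_{j\in J}\kappa_{P_j}$ (empty sum $\delta$) with $\{P_j\}$ exactly the set of predicates it satisfies. $E\vdash s=t$ is equational-logic derivability; $E$ sound means all closed instances of derivable equations are bisimilar. -}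

module Defs where

open import Data.Nat using (ℕ; suc)
open import Data.Fin using (Fin; zero; suc)
open import Data.Bool using (Bool; T)
open import Data.Unit using (⊤)
open import Data.Empty using (⊥)
open import Data.Sum using (_⊎_; inj₁; inj₂)
open import Data.Product using (Σ; _×_; _,_; proj₁; proj₂)
open import Relation.Binary.PropositionalEquality using (_≡_)
open import Relation.Nullary using (¬_)

record Sig : Set₁ where
  constructor mkSig
  field
    Op : Set
    ar : Op → ℕ

open Sig public

data Term (S : Sig) (V : Set) : Set where
  var : V → Term S V
  app : (f : Op S) → (Fin (ar S f) → Term S V) → Term S V

_[_] : {S : Sig} {V W : Set} → Term S V → (V → Term S W) → Term S W
var x [ σ ] = σ x
app f ts [ σ ] = app f (λ i → ts i [ σ ])

-- syntactic (extensional) identity of terms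
data _≈ₜ_ {S : Sig} {V : Set} : Term S V → Term S V → Set where
  var≈ : ∀ x → var x ≈ₜ var x
  app≈ : ∀ f ts us → (∀ i → ts i ≈ₜ us i) → app f ts ≈ₜ app f us

CTerm : Sig → Set
CTerm S = Term S ⊥

Eqn : Sig → Set
Eqn S = Term S ℕ × Term S ℕ

record AxiomSystem (S : Sig) : Set where
  constructor mkAx
  field
    size : ℕ
    axiom : Fin size → Eqn S

data _⊢_≐_ {S : Sig} (E : AxiomSystem S) : Term S ℕ → Term S ℕ → Set where
  ax    : ∀ k → E ⊢ proj₁ (AxiomSystem.axiom E k) ≐ proj₂ (AxiomSystem.axiom E k)
  refl  : ∀ t → E ⊢ t ≐ t
  sym   : ∀ {s t} → E ⊢ s ≐ t → E ⊢ t ≐ s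
  trans : ∀ {s t u} → E ⊢ s ≐ t → E ⊢ t ≐ u → E ⊢ s ≐ u
  subst : ∀ {s t} (σ : ℕ → Term S ℕ) → E ⊢ s ≐ t → E ⊢ (s [ σ ]) ≐ (t [ σ ])
  cong  : ∀ f ts us → (∀ i → E ⊢ ts i ≐ us i) → E ⊢ app f ts ≐ app f us

close : {S : Sig} → CTerm S → Term S ℕ
close t = t [ (λ ()) ]

module Preg (nA nP : ℕ) where

  Act : Set
  Act = Fin (suc nA)

  Pred : Set
  Pred = Fin nP

  data Concl (S : Sig) (V : Set) : Set where
    transC : Act → Term S V → Concl S V
    predC  : Pred → Concl S V

  -- a preg rule for an l-ary operation (the operation is fixed by where the
  -- rule is stored).  Source variables x_i are Fin l; the targets y of the
  -- positive transition premises are Fin kT (one per premise).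
  record Rule (S : Sig) (l : ℕ) : Set where
    field
      kT   : ℕ
      posT : Fin kT → Fin l × Act     -- x_i -a-> y_j
      kP   : ℕ
      posP : Fin kP → Fin l × Pred    -- P x_i
      kN   : ℕ
      negT : Fin kN → Fin l × Act     -- x_i -b-/->
      kQ   : ℕ
      negP : Fin kQ → Fin l × Pred    -- ¬ Q x_i
      concl : Concl S (Fin l ⊎ Fin kT)

  record System : Set₁ where
    field
      sig    : Sig
      RuleIx : Op sig → Set
      rule   : (f : Op sig) → RuleIx f → Rule sig (ar sig f)

  record PregSystem : Set where
    field
      nOps : ℕ
      arity : Fin nOps → ℕ
      nRules : Fin nOps → ℕ
      rules : (f : Fin nOps) → Fin (nRules f) → Rule (mkSig (Fin nOps) arity) (arity f)

  sigOf : PregSystem → Sig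
  sigOf G = mkSig (Fin (PregSystem.nOps G)) (PregSystem.arity G)

  module Semantics (G : System) where
    open System G
    open Rule

    TrConcl : {V : Set} → Concl sig V → Act → (V → CTerm sig) → CTerm sig → Set
    TrConcl (transC a C) c σ u = (a ≡ c) × ((C [ σ ]) ≈ₜ u)
    TrConcl (predC _) c σ u = ⊥

    PrConcl : {V : Set} → Concl sig V → Pred → Set
    PrConcl (transC _ _) P = ⊥
    PrConcl (predC Q) P = Q ≡ P

    env : ∀ {l k} → (Fin l → CTerm sig) → (Fin k → CTerm sig) → Fin l ⊎ Fin k → CTerm sig
    env ts ys (inj₁ i) = ts i
    env ts ys (inj₂ j) = ys j

    mutual
      Step : CTerm sig → Act → CTerm sig → Set
      Step (var ()) c u
      Step (app f ts) c u =
        Σ (RuleIx f) λ r → Σ (Fin (kT (rule f r)) → CTerm sig) λ ys →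
          (∀ j → Step (ts (proj₁ (posT (rule f r) j))) (proj₂ (posT (rule f r) j)) (ys j)) ×
          (∀ j → Holds (proj₂ (posP (rule f r) j)) (ts (proj₁ (posP (rule f r) j)))) ×
          (∀ j v → ¬ Step (ts (proj₁ (negT (rule f r) j))) (proj₂ (negT (rule f r) j)) v) ×
          (∀ j → ¬ Holds (proj₂ (negP (rule f r) j)) (ts (proj₁ (negP (rule f r) j)))) ×
          TrConcl (concl (rule f r)) c (env ts ys) u

      Holds : Pred → CTerm sig → Set
      Holds P (var ())
      Holds P (app f ts) =
        Σ (RuleIx f) λ r → Σ (Fin (kT (rule f r)) → CTerm sig) λ ys →
          (∀ j → Step (ts (proj₁ (posT (rule f r) j))) (proj₂ (posT (rule f r) j)) (ys j)) ×
          (∀ j → Holds (proj₂ (posP (rule f r) j)) (ts (proj₁ (posP (rule f r) j)))) ×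
          (∀ j v → ¬ Step (ts (proj₁ (negT (rule f r) j))) (proj₂ (negT (rule f r) j)) v) ×
          (∀ j → ¬ Holds (proj₂ (negP (rule f r) j)) (ts (proj₁ (negP (rule f r) j)))) ×
          PrConcl (concl (rule f r)) P

    record IsBisim (R : CTerm sig → CTerm sig → Set) : Set where
      field
        symm  : ∀ {s t} → R s t → R t s
        step  : ∀ {s t} → R s t → ∀ a s' → Step s a s' →
                Σ (CTerm sig) λ t' → Step t a t' × R s' t'
        preds : ∀ {s t} → R s t → ∀ P → Holds P s → Holds P t

    _∼_ : CTerm sig → CTerm sig → Set₁
    s ∼ t = Σ (CTerm sig → CTerm sig → Set) λ R → IsBisim R × R s t

    Sound : AxiomSystem sig → Set₁
    Sound E = ∀ s t → E ⊢ s ≐ t → (σ : ℕ → CTerm sig) → (s [ σ ]) ∼ (t [ σ ])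

  data FTPOp : Set where
    δ    : FTPOp
    κ    : Pred → FTPOp
    pre  : Act → FTPOp
    plus : FTPOp

  ftpAr : FTPOp → ℕ
  ftpAr δ = 0
  ftpAr (κ _) = 0
  ftpAr (pre _) = 1
  ftpAr plus = 2

  -- Extensions G ⊑ G' of a preg system G that contain Σ_FTP:
  -- the operations of G' are those of G, the FTP operations and finitely
  -- many further operations; rules for G's operations are exactly G's
  -- rules, rules for FTP operations are exactly the FTP rules (plus the
  -- rules  P x ⇒ P(a.x)  for the designated implicit predicates D), and
  -- arbitrary finitely many preg rules for the further operations.

  module _ (G : PregSystem) where
    open PregSystem G

    OpX : ℕ → Set
    OpX m = Fin nOps ⊎ (FTPOp ⊎ Fin m)

    arX : (m : ℕ) → (Fin m → ℕ) → OpX m → ℕ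
    arX m arE (inj₁ f) = arity f
    arX m arE (inj₂ (inj₁ o)) = ftpAr o
    arX m arE (inj₂ (inj₂ g)) = arE g

    SigX : (m : ℕ) → (Fin m → ℕ) → Sig
    SigX m arE = mkSig (OpX m) (arX m arE)

    record Extension : Set where
      field
        m     : ℕ
        arE   : Fin m → ℕ
        nrE   : Fin m → ℕ
        ruleE : (g : Fin m) → Fin (nrE g) → Rule (SigX m arE) (arE g)

    module _ (X : Extension) where
      open Extension X

      S' : Sig
      S' = SigX m arE

      embT : {V : Set} → Term (sigOf G) V → Term S' V
      embT (var x) = var x
      embT (app f ts) = app (inj₁ f) (λ i → embT (ts i))

      embC : {V : Set} → Concl (sigOf G) V → Concl S' V
      embC (transC a C) = transC a (embT C)
      embC (predC P) = predC P

      embR : ∀ {l} → Rule (sigOf G) l → Rule S' l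
      embR R = record
        { kT = kT ; posT = posT ; kP = kP ; posP = posP
        ; kN = kN ; negT = negT ; kQ = kQ ; negP = negP
        ; concl = embC concl }
        where open Rule R

      noPrem : ∀ {l} → Concl S' (Fin l ⊎ Fin 0) → Rule S' l
      noPrem c = record
        { kT = 0 ; posT = λ () ; kP = 0 ; posP = λ ()
        ; kN = 0 ; negT = λ () ; kQ = 0 ; negP = λ () ; concl = c }

      oneTrans : ∀ {l} → Fin l → Act → Rule S' l
      oneTrans i a = record
        { kT = 1 ; posT = λ _ → (i , a) ; kP = 0 ; posP = λ ()
        ; kN = 0 ; negT = λ () ; kQ = 0 ; negP = λ ()
        ; concl = transC a (var (inj₂ zero)) }

      onePred : ∀ {l} → Fin l → Pred → Rule S' l
      onePred i P = record
        { kT = 0 ; posT = λ () ; kP = 1 ; posP = λ _ → (i , P)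
        ; kN = 0 ; negT = λ () ; kQ = 0 ; negP = λ ()
        ; concl = predC P }

      FTPIx : (Pred → Bool) → FTPOp → Set
      FTPIx D δ = ⊥
      FTPIx D (κ _) = ⊤
      FTPIx D (pre _) = ⊤ ⊎ Σ Pred (λ P → T (D P))
      FTPIx D plus = (Act ⊎ Act) ⊎ (Pred ⊎ Pred)

      ftpRule : (D : Pred → Bool) (o : FTPOp) → FTPIx D o → Rule S' (ftpAr o)
      ftpRule D δ ()
      ftpRule D (κ P) _ = noPrem (predC P)                         -- P κ_P
      ftpRule D (pre a) (inj₁ _) = noPrem (transC a (var (inj₁ zero)))  -- a.x -a-> x
      ftpRule D (pre a) (inj₂ (P , _)) = onePred zero P            -- P x ⇒ P(a.x), P ∈ D
      ftpRule D plus (inj₁ (inj₁ a)) = oneTrans zero a             -- x -a-> x' ⇒ x+y -a-> x'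
      ftpRule D plus (inj₁ (inj₂ a)) = oneTrans (suc zero) a       -- y -a-> y' ⇒ x+y -a-> y'
      ftpRule D plus (inj₂ (inj₁ P)) = onePred zero P              -- P x ⇒ P(x+y)
      ftpRule D plus (inj₂ (inj₂ P)) = onePred (suc zero) P        -- P y ⇒ P(x+y)

      IxX : (Pred → Bool) → OpX m → Set
      IxX D (inj₁ f) = Fin (nRules f)
      IxX D (inj₂ (inj₁ o)) = FTPIx D o
      IxX D (inj₂ (inj₂ g)) = Fin (nrE g)

      ruleX : (D : Pred → Bool) (f : OpX m) → IxX D f → Rule S' (arX m arE f)
      ruleX D (inj₁ f) r = embR (rules f r)
      ruleX D (inj₂ (inj₁ o)) r = ftpRule D o r
      ruleX D (inj₂ (inj₂ g)) r = ruleE g r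

      G' : (Pred → Bool) → System
      G' D = record { sig = S' ; RuleIx = IxX D ; rule = ruleX D }

      δ' : Op S'
      δ' = inj₂ (inj₁ δ)
      κ' : Pred → Op S'
      κ' P = inj₂ (inj₁ (κ P))
      pre' : Act → Op S'
      pre' a = inj₂ (inj₁ (pre a))
      plus' : Op S'
      plus' = inj₂ (inj₁ plus)

      data IsSum : CTerm S' → Set where
        sPre  : ∀ a ts → IsSum (app (pre' a) ts)
        sκ    : ∀ P ts → IsSum (app (κ' P) ts)
        sPlus : ∀ ts → IsSum (ts zero) → IsSum (ts (suc zero)) → IsSum (app plus' ts)

      data KappaIn (P : Pred) : CTerm S' → Set where
        here  : ∀ ts → KappaIn P (app (κ' P) ts)
        left  : ∀ ts → KappaIn P (ts zero) → KappaIn P (app plus' ts)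
        right : ∀ ts → KappaIn P (ts (suc zero)) → KappaIn P (app plus' ts)

      IsDelta : CTerm S' → Set
      IsDelta (var ())
      IsDelta (app f ts) = f ≡ δ'

      HNF : (Pred → Bool) → CTerm S' → Set
      HNF D u = (IsDelta u ⊎ IsSum u) ×
                (∀ P → Semantics.Holds (G' D) P u → KappaIn P u) ×
                (∀ P → KappaIn P u → Semantics.Holds (G' D) P u)

      HeadNormalizing : (Pred → Bool) → AxiomSystem S' → Set
      HeadNormalizing D E = (t : CTerm S') →
        Σ (CTerm S') λ u → HNF D u × (E ⊢ close t ≐ close u)

module Submission where

-- For every rule c of G, G′ has an auxiliary operation F_c
-- with one argument per source variable of c and one further argument, a
-- "slot", per premise of c; its only rule is c with each premise moved to
-- its own slot.  The axioms of E are: associativity of + and the δ-unit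
-- laws; the expansion f(x) = Σ_c F_c(x, copies of x) over the rules c of f;
-- for a positive slot, laws pushing F_c through δ, +, a.x and κ_Q in that
-- slot; for a negative slot, laws dropping a first summand a.x or κ_Q that
-- cannot violate the premise (and sending F_c to δ if it does); and the
-- fire law, F_c on canonical arguments equals the conclusion of c.

open import Defs
open import Data.Bool using (Bool; false)
open import Data.Empty using (⊥; ⊥-elim)
open import Data.Fin using (Fin; zero; suc; toℕ; _↑ˡ_; _↑ʳ_; splitAt)
open import Data.Fin.Properties using (splitAt-↑ˡ; splitAt-↑ʳ; splitAt⁻¹-↑ˡ; splitAt⁻¹-↑ʳ) renaming (_≟_ to _≟F_)
open import Data.List using (List; []; _∷_; length; lookup; map; _++_; concatMap; allFin; filter)
open import Data.List.Membership.Propositional using (_∈_)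
open import Data.List.Membership.Propositional.Properties
  using (∈-map⁺; ∈-map⁻; ∈-++⁺ˡ; ∈-++⁺ʳ; ∈-concatMap⁺; ∈-allFin; ∈-filter⁺; ∈-filter⁻)
open import Data.List.Relation.Unary.Any as Any using (here; there)
open import Data.List.Relation.Unary.Any.Properties using (lookup-index)
open import Data.Nat using (ℕ; zero; suc; _+_)
open import Data.Product using (Σ; _×_; _,_; proj₁; proj₂)
open import Data.Sum using (_⊎_; inj₁; inj₂; [_,_]′)
open import Data.Sum.Properties using (≡-dec; inj₂-injective)
open import Data.Vec.Functional using (updateAt)
open import Data.Vec.Functional.Properties using (updateAt-updates; updateAt-minimal; updateAt-updateAt; updateAt-id-local)
open import Function using (_∘_; id)
open import Relation.Binary.Definitions using (DecidableEquality)
open import Relation.Binary.PropositionalEquality as ≡ using (_≡_; _≢_; refl; _≗_)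
open import Relation.Nullary using (¬_; Dec; yes; no)

module _ {S : Sig} where

  ≈-refl : {V : Set} (t : Term S V) → t ≈ₜ t
  ≈-refl (var x) = var≈ x
  ≈-refl (app f ts) = app≈ f ts ts (λ i → ≈-refl (ts i))

  ≈-sym : {V : Set} {s t : Term S V} → s ≈ₜ t → t ≈ₜ s
  ≈-sym (var≈ x) = var≈ x
  ≈-sym (app≈ f ts us p) = app≈ f us ts (λ i → ≈-sym (p i))

  ≈-trans : {V : Set} {s t u : Term S V} → s ≈ₜ t → t ≈ₜ u → s ≈ₜ u
  ≈-trans (var≈ x) q = q
  ≈-trans (app≈ f ts us p) (app≈ .f .us vs q) = app≈ f ts vs (λ i → ≈-trans (p i) (q i))

  ≡⇒≈ : {V : Set} {s t : Term S V} → s ≡ t → s ≈ₜ t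
  ≡⇒≈ {s = s} refl = ≈-refl s

  subst-comp : {U V W : Set} (t : Term S U) (τ : U → Term S V) (σ : V → Term S W) →
               ((t [ τ ]) [ σ ]) ≈ₜ (t [ (λ v → τ v [ σ ]) ])
  subst-comp (var x) τ σ = ≈-refl _
  subst-comp (app f ts) τ σ = app≈ f _ _ (λ i → subst-comp (ts i) τ σ)

  subst-cong : {V W : Set} (t : Term S V) {σ σ' : V → Term S W} → (∀ v → σ v ≈ₜ σ' v) →
               (t [ σ ]) ≈ₜ (t [ σ' ])
  subst-cong (var x) e = e x
  subst-cong (app f ts) e = app≈ f _ _ (λ i → subst-cong (ts i) e)

  ≈-subst : {V W : Set} {s t : Term S V} (σ : V → Term S W) → s ≈ₜ t → (s [ σ ]) ≈ₜ (t [ σ ])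
  ≈-subst σ (var≈ x) = ≈-refl _
  ≈-subst σ (app≈ f ts us p) = app≈ f _ _ (λ i → ≈-subst σ (p i))

  ≈⇒⊢ : (E : AxiomSystem S) {s t : Term S ℕ} → s ≈ₜ t → E ⊢ s ≐ t
  ≈⇒⊢ E (var≈ x) = refl (var x)
  ≈⇒⊢ E (app≈ f ts us p) = cong f ts us (λ i → ≈⇒⊢ E (p i))

-- A layout of A as the finite set Fin size.  The arguments of an auxiliary
-- operation F_c form a sum type (source variables and premise slots); its
-- arity is the size of a layout of that type.
record Layout (A : Set) : Set where
  field
    size          : ℕ
    encode        : A → Fin size
    decode        : Fin size → A
    decode-encode : ∀ a → decode (encode a) ≡ a
    encode-decode : ∀ k → encode (decode k) ≡ k

  decode⇒encode : ∀ {k a} → decode k ≡ a → k ≡ encode a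
  decode⇒encode {k} e = ≡.trans (≡.sym (encode-decode k)) (≡.cong encode e)

  encode-injective : ∀ {a b} → a ≢ b → encode a ≢ encode b
  encode-injective a≢b e = a≢b (≡.trans (≡.sym (decode-encode _)) (≡.trans (≡.cong decode e) (decode-encode _)))

finLayout : ∀ n → Layout (Fin n)
finLayout n = record
  { size = n ; encode = λ k → k ; decode = λ k → k
  ; decode-encode = λ _ → refl ; encode-decode = λ _ → refl }

_⊎ᴸ_ : {A B : Set} → Layout A → Layout B → Layout (A ⊎ B)
_⊎ᴸ_ {A} {B} LA LB = record
  { size = LA.size + LB.size ; encode = enc ; decode = dec
  ; decode-encode = dec-enc ; encode-decode = enc-dec }
  where
  module LA = Layout LA
  module LB = Layout LB
  enc : A ⊎ B → Fin (LA.size + LB.size)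
  enc (inj₁ a) = LA.encode a ↑ˡ LB.size
  enc (inj₂ b) = LA.size ↑ʳ LB.encode b
  dec′ : Fin LA.size ⊎ Fin LB.size → A ⊎ B
  dec′ (inj₁ i) = inj₁ (LA.decode i)
  dec′ (inj₂ j) = inj₂ (LB.decode j)
  dec : Fin (LA.size + LB.size) → A ⊎ B
  dec k = dec′ (splitAt LA.size k)
  dec-enc : ∀ x → dec (enc x) ≡ x
  dec-enc (inj₁ a) rewrite splitAt-↑ˡ LA.size (LA.encode a) LB.size = ≡.cong inj₁ (LA.decode-encode a)
  dec-enc (inj₂ b) rewrite splitAt-↑ʳ LA.size LB.size (LB.encode b) = ≡.cong inj₂ (LB.decode-encode b)
  enc-dec : ∀ k → enc (dec k) ≡ k
  enc-dec k with splitAt LA.size k in eq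
  ... | inj₁ i = ≡.trans (≡.cong (_↑ˡ LB.size) (LA.encode-decode i)) (splitAt⁻¹-↑ˡ eq)
  ... | inj₂ j = ≡.trans (≡.cong (LA.size ↑ʳ_) (LB.encode-decode j)) (splitAt⁻¹-↑ʳ eq)

-- A complete finite enumeration of a type.  Finite axiom systems are
-- obtained by enumerating a type of axiom names.
record Listing (A : Set) : Set where
  field
    list     : List A
    complete : ∀ x → x ∈ list

  count : ℕ
  count = length list

  nth : Fin count → A
  nth = lookup list

  position : A → Fin count
  position x = Any.index (complete x)

  nth-position : ∀ x → nth (position x) ≡ x
  nth-position x = ≡.sym (lookup-index (complete x))

listFin : ∀ n → Listing (Fin n)
listFin n = record { list = allFin n ; complete = ∈-allFin }

_⊎ˡ_ : {A B : Set} → Listing A → Listing B → Listing (A ⊎ B)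
LA ⊎ˡ LB = record
  { list = map inj₁ (list LA) ++ map inj₂ (list LB)
  ; complete = λ { (inj₁ a) → ∈-++⁺ˡ (∈-map⁺ inj₁ (complete LA a))
                 ; (inj₂ b) → ∈-++⁺ʳ _ (∈-map⁺ inj₂ (complete LB b)) } }
  where open Listing

Σˡ : {A : Set} {B : A → Set} → Listing A → (∀ a → Listing (B a)) → Listing (Σ A B)
Σˡ {B = B} LA LB = record
  { list = concatMap fibre (list LA)
  ; complete = λ { (a , b) → ∈-concatMap⁺ fibre
      (Any.map (λ { refl → ∈-map⁺ (a ,_) (complete (LB a) b) }) (complete LA a)) } }
  where
  open Listing
  fibre : (a : _) → List (Σ _ B)
  fibre a = map (a ,_) (list (LB a))

axiomsFrom : {S : Sig} {I : Set} → Listing I → (I → Eqn S) → AxiomSystem S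
axiomsFrom L eqn = mkAx (Listing.count L) (λ k → eqn (Listing.nth L k))

useAxiom : {S : Sig} {I : Set} (L : Listing I) (eqn : I → Eqn S) (i : I) →
           axiomsFrom L eqn ⊢ proj₁ (eqn i) ≐ proj₂ (eqn i)
useAxiom L eqn i =
  ≡.subst (λ e → axiomsFrom L eqn ⊢ proj₁ e ≐ proj₂ e) (≡.cong eqn (Listing.nth-position L i))
          (ax (Listing.position L i))

infixl 9 _⟨_≔_⟩
_⟨_≔_⟩ : {A : Set} {n : ℕ} → (Fin n → A) → Fin n → A → Fin n → A
xs ⟨ i ≔ v ⟩ = updateAt xs i (λ _ → v)

module _ {A : Set} {n : ℕ} where

  ≔-same : (xs : Fin n → A) (i : Fin n) (v : A) → (xs ⟨ i ≔ v ⟩) i ≡ v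
  ≔-same xs i v = updateAt-updates i xs

  ≔-other : (xs : Fin n → A) {i j : Fin n} (v : A) → j ≢ i → (xs ⟨ i ≔ v ⟩) j ≡ xs j
  ≔-other xs {i} {j} v j≢i = updateAt-minimal j i xs j≢i

  ≔-≔ : (xs : Fin n → A) (i : Fin n) (v w : A) → (xs ⟨ i ≔ v ⟩) ⟨ i ≔ w ⟩ ≗ xs ⟨ i ≔ w ⟩
  ≔-≔ xs i v w = updateAt-updateAt i xs

  ≔-self : (xs : Fin n → A) (i : Fin n) → xs ⟨ i ≔ xs i ⟩ ≗ xs
  ≔-self xs i = updateAt-id-local i xs refl

  ≔-cong : (R : A → A → Set) → (∀ a → R a a) → (xs : Fin n → A) (i : Fin n) {v v' : A} → R v v' →
           ∀ k → R ((xs ⟨ i ≔ v ⟩) k) ((xs ⟨ i ≔ v' ⟩) k)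
  ≔-cong R R-refl xs i {v} {v'} r k with k ≟F i
  ... | yes refl = ≡.subst₂ R (≡.sym (≔-same xs i v)) (≡.sym (≔-same xs i v')) r
  ... | no k≢i = ≡.subst₂ R (≡.sym (≔-other xs v k≢i)) (≡.sym (≔-other xs v' k≢i)) (R-refl (xs k))

  ≔-resp : {xs ys : Fin n → A} (i : Fin n) (v : A) → xs ≗ ys → xs ⟨ i ≔ v ⟩ ≗ ys ⟨ i ≔ v ⟩
  ≔-resp {xs} {ys} i v xs≗ys k with k ≟F i
  ... | yes refl = ≡.trans (≔-same xs i v) (≡.sym (≔-same ys i v))
  ... | no k≢i = ≡.trans (≔-other xs v k≢i) (≡.trans (xs≗ys k) (≡.sym (≔-other ys v k≢i)))

  ≔-map : {B : Set} (f : A → B) (xs : Fin n → A) (i : Fin n) (v : A) →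
          (λ k → f ((xs ⟨ i ≔ v ⟩) k)) ≗ (λ k → f (xs k)) ⟨ i ≔ f v ⟩
  ≔-map f xs i v k with k ≟F i
  ... | yes refl = ≡.trans (≡.cong f (≔-same xs i v)) (≡.sym (updateAt-updates i (λ k → f (xs k))))
  ... | no k≢i = ≡.trans (≡.cong f (≔-other xs v k≢i)) (≡.sym (updateAt-minimal k i (λ k → f (xs k)) k≢i))

envℕ : {X : Set} {n : ℕ} → (Fin n → X) → X → ℕ → X
envℕ {n = zero} ts e k = e
envℕ {n = suc n} ts e zero = ts zero
envℕ {n = suc n} ts e (suc k) = envℕ (λ i → ts (suc i)) e k

envℕ-at : {X : Set} {n : ℕ} (ts : Fin n → X) (e : X) (i : Fin n) → envℕ ts e (toℕ i) ≡ ts i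
envℕ-at ts e zero = refl
envℕ-at ts e (suc i) = envℕ-at (λ j → ts (suc j)) e i

envℕ-beyond : {X : Set} (n : ℕ) (ts : Fin n → X) (e : X) → envℕ ts e n ≡ e
envℕ-beyond zero ts e = refl
envℕ-beyond (suc n) ts e = envℕ-beyond n (λ j → ts (suc j)) e

-- Preg rules test
-- their arguments only through transitions and predicates, so ≃ᴱ is a
-- bisimulation as soon as every axiom instance has the one-step transfer
-- property up to ≃ᴱ; every derivable equation is then sound.
module Transfer (nA nP : ℕ) (Sy : Preg.System nA nP) (E : AxiomSystem (Preg.System.sig Sy)) where
  open Preg nA nP
  open System Sy
  open Semantics Sy
  open Rule

  CT : Set
  CT = CTerm sig

  lhs rhs : Fin (AxiomSystem.size E) → Term sig ℕ
  lhs k = proj₁ (AxiomSystem.axiom E k)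
  rhs k = proj₂ (AxiomSystem.axiom E k)

  infix 4 _≃ᴱ_
  data _≃ᴱ_ : CT → CT → Set where
    inst  : ∀ k (σ : ℕ → CT) → (lhs k [ σ ]) ≃ᴱ (rhs k [ σ ])
    ≃sym  : ∀ {s t} → s ≃ᴱ t → t ≃ᴱ s
    ≃tr   : ∀ {s t u} → s ≃ᴱ t → t ≃ᴱ u → s ≃ᴱ u
    ≃cong : ∀ f ts us → (∀ i → ts i ≃ᴱ us i) → app f ts ≃ᴱ app f us

  ≈⇒≃ : {s t : CT} → s ≈ₜ t → s ≃ᴱ t
  ≈⇒≃ (var≈ ())
  ≈⇒≃ (app≈ f ts us p) = ≃cong f ts us (λ i → ≈⇒≃ (p i))

  ≃refl : (t : CT) → t ≃ᴱ t
  ≃refl t = ≈⇒≃ (≈-refl t)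

  ≃subst : {V : Set} (C : Term sig V) {σ σ' : V → CT} → (∀ v → σ v ≃ᴱ σ' v) →
           (C [ σ ]) ≃ᴱ (C [ σ' ])
  ≃subst (var x) e = e x
  ≃subst (app f ts) e = ≃cong f _ _ (λ i → ≃subst (ts i) e)

  Forth : CT → CT → Set
  Forth s t = ∀ a s' → Step s a s' → Σ CT λ t' → Step t a t' × s' ≃ᴱ t'

  infix 4 _⇄_
  record _⇄_ (s t : CT) : Set where
    field
      forth      : Forth s t
      back       : Forth t s
      pred-forth : ∀ P → Holds P s → Holds P t
      pred-back  : ∀ P → Holds P t → Holds P s
  open _⇄_ public

  ⇄-sym : ∀ {s t} → s ⇄ t → t ⇄ s
  ⇄-sym T = record { forth = back T ; back = forth T ; pred-forth = pred-back T ; pred-back = pred-forth T }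

  ⇄-trans : ∀ {s t u} → s ⇄ t → t ⇄ u → s ⇄ u
  ⇄-trans A B = record
    { forth = chase (forth A) (forth B) ; back = chase (back B) (back A)
    ; pred-forth = λ P h → pred-forth B P (pred-forth A P h)
    ; pred-back = λ P h → pred-back A P (pred-back B P h) }
    where
    chase : ∀ {x y z} → Forth x y → Forth y z → Forth x z
    chase f g a x' st = let (y' , st₁ , e₁) = f a x' st ; (z' , st₂ , e₂) = g a y' st₁ in z' , st₂ , ≃tr e₁ e₂

  conclusion-cong : {V : Set} (cc : Concl sig V) (c : Act) {σ σ' : V → CT} {u : CT} →
                    (∀ v → σ v ≃ᴱ σ' v) → TrConcl cc c σ u → Σ CT λ u' → TrConcl cc c σ' u' × u ≃ᴱ u'
  conclusion-cong (transC a C) c {σ' = σ'} e (a≡c , C≈u) =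
    C [ σ' ] , (a≡c , ≈-refl _) , ≃tr (≃sym (≈⇒≃ C≈u)) (≃subst C e)
  conclusion-cong (predC _) c e ()

  env-cong : ∀ {l k} {ts us : Fin l → CT} {ys ys' : Fin k → CT} →
             (∀ i → ts i ≃ᴱ us i) → (∀ j → ys j ≃ᴱ ys' j) → ∀ v → env ts ys v ≃ᴱ env us ys' v
  env-cong p q (inj₁ i) = p i
  env-cong p q (inj₂ j) = q j

  -- Congruence: transfer of the arguments gives transfer of f(ts).  A rule
  -- firing for ts fires for us: positive premises are transferred forth,
  -- negative ones back.
  app-forth : ∀ f ts us → (∀ i → ts i ⇄ us i) → (∀ i → ts i ≃ᴱ us i) → Forth (app f ts) (app f us)
  app-forth f ts us T p c u (r , ys , pT , pP , nT , nQ , tc) =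
    let R = rule f r
        target = λ j → forth (T (proj₁ (posT R j))) _ _ (pT j)
        (u' , tc' , e) = conclusion-cong (concl R) c (env-cong p (λ j → proj₂ (proj₂ (target j)))) tc
    in u' , (r , (λ j → proj₁ (target j)) , (λ j → proj₁ (proj₂ (target j)))
                , (λ j → pred-forth (T (proj₁ (posP R j))) _ (pP j))
                , (λ j v st → nT j _ (proj₁ (proj₂ (back (T (proj₁ (negT R j))) _ v st))))
                , (λ j h → nQ j (pred-back (T (proj₁ (negP R j))) _ h))
                , tc') , e

  app-pred : ∀ f ts us → (∀ i → ts i ⇄ us i) → ∀ P → Holds P (app f ts) → Holds P (app f us)
  app-pred f ts us T P (r , ys , pT , pP , nT , nQ , pc) =
    let R = rule f r
        target = λ j → forth (T (proj₁ (posT R j))) _ _ (pT j)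
    in r , (λ j → proj₁ (target j)) , (λ j → proj₁ (proj₂ (target j)))
         , (λ j → pred-forth (T (proj₁ (posP R j))) _ (pP j))
         , (λ j v st → nT j _ (proj₁ (proj₂ (back (T (proj₁ (negT R j))) _ v st))))
         , (λ j h → nQ j (pred-back (T (proj₁ (negP R j))) _ h))
         , pc

  app-⇄ : ∀ f ts us → (∀ i → ts i ⇄ us i) → (∀ i → ts i ≃ᴱ us i) → app f ts ⇄ app f us
  app-⇄ f ts us T p = record
    { forth = app-forth f ts us T p
    ; back = app-forth f us ts (λ i → ⇄-sym (T i)) (λ i → ≃sym (p i))
    ; pred-forth = app-pred f ts us T
    ; pred-back = app-pred f us ts (λ i → ⇄-sym (T i)) }

  ≈⇒⇄ : {s t : CT} → s ≈ₜ t → s ⇄ t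
  ≈⇒⇄ (var≈ ())
  ≈⇒⇄ (app≈ f ts us p) = app-⇄ f ts us (λ i → ≈⇒⇄ (p i)) (λ i → ≈⇒≃ (p i))

  ≈-holds : ∀ {s t P} → s ≈ₜ t → Holds P s → Holds P t
  ≈-holds e = pred-forth (≈⇒⇄ e) _

  ⇄-refl : (t : CT) → t ⇄ t
  ⇄-refl t = ≈⇒⇄ (≈-refl t)

  ⇄-resp : {l l' r r' : CT} → l ≈ₜ l' → l' ⇄ r' → r ≈ₜ r' → l ⇄ r
  ⇄-resp e T e' = ⇄-trans (≈⇒⇄ e) (⇄-trans T (≈⇒⇄ (≈-sym e')))

  mirror-⇄ : {s t : CT} → (∀ {a u} → Step s a u → Step t a u) → (∀ {a u} → Step t a u → Step s a u) →
             (∀ {P} → Holds P s → Holds P t) → (∀ {P} → Holds P t → Holds P s) → s ⇄ t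
  mirror-⇄ f b hf hb = record
    { forth = λ a u st → u , f st , ≃refl u ; back = λ a u st → u , b st , ≃refl u
    ; pred-forth = λ P → hf ; pred-back = λ P → hb }

  Inert : CT → Set
  Inert t = (∀ a u → ¬ Step t a u) × (∀ P → ¬ Holds P t)

  ≈-inert : {s t : CT} → s ≈ₜ t → Inert t → Inert s
  ≈-inert e (dt , dth) = (λ a u st → dt a _ (proj₁ (proj₂ (forth (≈⇒⇄ e) a u st))))
                       , (λ P h → dth P (pred-forth (≈⇒⇄ e) P h))

  inert-⇄ : {s t : CT} → Inert s → Inert t → s ⇄ t
  inert-⇄ (ds , dh) (dt , dth) = record
    { forth = λ a u st → ⊥-elim (ds a u st) ; back = λ a u st → ⊥-elim (dt a u st)
    ; pred-forth = λ P h → ⊥-elim (dh P h) ; pred-back = λ P h → ⊥-elim (dth P h) }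

  module _ (axiom-⇄ : ∀ k σ → (lhs k [ σ ]) ⇄ (rhs k [ σ ])) where

    ≃⇒⇄ : ∀ {s t} → s ≃ᴱ t → s ⇄ t
    ≃⇒⇄ (inst k σ) = axiom-⇄ k σ
    ≃⇒⇄ (≃sym e) = ⇄-sym (≃⇒⇄ e)
    ≃⇒⇄ (≃tr e e') = ⇄-trans (≃⇒⇄ e) (≃⇒⇄ e')
    ≃⇒⇄ (≃cong f ts us p) = app-⇄ f ts us (λ i → ≃⇒⇄ (p i)) p

    ≃-bisim : IsBisim _≃ᴱ_
    ≃-bisim = record
      { symm = ≃sym ; step = λ e → forth (≃⇒⇄ e) ; preds = λ e → pred-forth (≃⇒⇄ e) }

    derivable⇒≃ : ∀ {s t} → E ⊢ s ≐ t → (σ : ℕ → CT) → (s [ σ ]) ≃ᴱ (t [ σ ])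
    derivable⇒≃ (ax k) σ = inst k σ
    derivable⇒≃ (refl t) σ = ≃refl _
    derivable⇒≃ (sym d) σ = ≃sym (derivable⇒≃ d σ)
    derivable⇒≃ (trans d d') σ = ≃tr (derivable⇒≃ d σ) (derivable⇒≃ d' σ)
    derivable⇒≃ (subst {s} {t} τ d) σ =
      ≃tr (≈⇒≃ (subst-comp s τ σ))
          (≃tr (derivable⇒≃ d (λ v → τ v [ σ ])) (≈⇒≃ (≈-sym (subst-comp t τ σ))))
    derivable⇒≃ (cong f ts us ps) σ = ≃cong f _ _ (λ i → derivable⇒≃ (ps i) σ)

    sound-by-transfer : Sound E
    sound-by-transfer s t d σ = _≃ᴱ_ , ≃-bisim , derivable⇒≃ d σ

module FTP (nA nP : ℕ) (G : Preg.PregSystem nA nP) (X : Preg.Extension nA nP G) where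
  open Preg nA nP

  noImplicit : Pred → Bool
  noImplicit _ = false

  open Semantics (G' G X noImplicit)

  CT : Set
  CT = CTerm (S' G X)

  pair : {V : Set} → Term (S' G X) V → Term (S' G X) V → Fin 2 → Term (S' G X) V
  pair t u zero = t
  pair t u (suc zero) = u

  infixr 5 _⊕_
  _⊕_ : {V : Set} → Term (S' G X) V → Term (S' G X) V → Term (S' G X) V
  t ⊕ u = app (plus' G X) (pair t u)

  infixr 6 _·_
  _·_ : {V : Set} → Act → Term (S' G X) V → Term (S' G X) V
  a · t = app (pre' G X a) (λ _ → t)

  κₜ : {V : Set} → Pred → Term (S' G X) V
  κₜ P = app (κ' G X P) (λ ())

  δₜ : {V : Set} → Term (S' G X) V
  δₜ = app (δ' G X) (λ ())

  TrConcl-target : {V : Set} (cc : Concl (S' G X) V) {a : Act} {σ : V → CT} {u u' : CT} →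
                   TrConcl cc a σ u → u ≈ₜ u' → TrConcl cc a σ u'
  TrConcl-target (transC b C) (b≡a , C≈u) u≈u' = b≡a , ≈-trans C≈u u≈u'
  TrConcl-target (predC _) () _

  TrConcl-env : {V : Set} (cc : Concl (S' G X) V) {a : Act} {σ σ' : V → CT} {u : CT} →
                (∀ v → σ' v ≈ₜ σ v) → TrConcl cc a σ u → TrConcl cc a σ' u
  TrConcl-env (transC b C) e (b≡a , C≈u) = b≡a , ≈-trans (subst-cong C e) C≈u
  TrConcl-env (predC _) e ()

  step-≈ : ∀ {t a u u'} → Step t a u → u ≈ₜ u' → Step t a u'
  step-≈ {var ()}
  step-≈ {app f ts} (r , ys , pT , pP , nT , nQ , tc) u≈u' =
    r , ys , pT , pP , nT , nQ , TrConcl-target (Rule.concl (System.rule (G' G X noImplicit) f r)) tc u≈u'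

  -- The + lemmas are stated for arbitrary argument vectors, so that they
  -- apply to instances (t ⊕ u) [ σ ] without rewriting.
  ⊕-step-inv : ∀ ts {a u} → Step (app (plus' G X) ts) a u → Step (ts zero) a u ⊎ Step (ts (suc zero)) a u
  ⊕-step-inv ts (inj₁ (inj₁ b) , ys , pT , _ , _ , _ , (refl , e)) = inj₁ (step-≈ (pT zero) e)
  ⊕-step-inv ts (inj₁ (inj₂ b) , ys , pT , _ , _ , _ , (refl , e)) = inj₂ (step-≈ (pT zero) e)
  ⊕-step-inv ts (inj₂ (inj₁ _) , _ , _ , _ , _ , _ , ())
  ⊕-step-inv ts (inj₂ (inj₂ _) , _ , _ , _ , _ , _ , ())

  ⊕-stepˡ : ∀ ts {a u} → Step (ts zero) a u → Step (app (plus' G X) ts) a u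
  ⊕-stepˡ ts st = inj₁ (inj₁ _) , (λ _ → _) , (λ _ → st) , (λ ()) , (λ ()) , (λ ()) , (refl , ≈-refl _)

  ⊕-stepʳ : ∀ ts {a u} → Step (ts (suc zero)) a u → Step (app (plus' G X) ts) a u
  ⊕-stepʳ ts st = inj₁ (inj₂ _) , (λ _ → _) , (λ _ → st) , (λ ()) , (λ ()) , (λ ()) , (refl , ≈-refl _)

  ⊕-holds-inv : ∀ ts {P} → Holds P (app (plus' G X) ts) → Holds P (ts zero) ⊎ Holds P (ts (suc zero))
  ⊕-holds-inv ts (inj₁ (inj₁ _) , _ , _ , _ , _ , _ , ())
  ⊕-holds-inv ts (inj₁ (inj₂ _) , _ , _ , _ , _ , _ , ())
  ⊕-holds-inv ts (inj₂ (inj₁ _) , _ , _ , pP , _ , _ , refl) = inj₁ (pP zero)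
  ⊕-holds-inv ts (inj₂ (inj₂ _) , _ , _ , pP , _ , _ , refl) = inj₂ (pP zero)

  ⊕-holdsˡ : ∀ ts {P} → Holds P (ts zero) → Holds P (app (plus' G X) ts)
  ⊕-holdsˡ ts h = inj₂ (inj₁ _) , (λ ()) , (λ ()) , (λ _ → h) , (λ ()) , (λ ()) , refl

  ⊕-holdsʳ : ∀ ts {P} → Holds P (ts (suc zero)) → Holds P (app (plus' G X) ts)
  ⊕-holdsʳ ts h = inj₂ (inj₂ _) , (λ ()) , (λ ()) , (λ _ → h) , (λ ()) , (λ ()) , refl

  ·-step-inv : ∀ a (t : CT) {b u} → Step (a · t) b u → (a ≡ b) × (t ≈ₜ u)
  ·-step-inv a t (inj₁ _ , _ , _ , _ , _ , _ , tc) = tc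
  ·-step-inv a t (inj₂ (_ , ()) , _)

  ·-step : ∀ {a} {t : CT} → Step (a · t) a t
  ·-step = inj₁ _ , (λ ()) , (λ ()) , (λ ()) , (λ ()) , (λ ()) , (refl , ≈-refl _)

  -- without implicit predicates a prefix satisfies no predicate
  ·-no-pred : ∀ a (t : CT) {P} → ¬ Holds P (a · t)
  ·-no-pred a t (inj₁ _ , _ , _ , _ , _ , _ , ())
  ·-no-pred a t (inj₂ (_ , ()) , _)

  κ-no-step : ∀ Q {a u} → ¬ Step (κₜ Q) a u
  κ-no-step Q (_ , _ , _ , _ , _ , _ , ())

  κ-holds-inv : ∀ Q {P} → Holds P (κₜ Q) → Q ≡ P
  κ-holds-inv Q (_ , _ , _ , _ , _ , _ , e) = e

  κ-holds : ∀ P → Holds P (κₜ P)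
  κ-holds P = _ , (λ ()) , (λ ()) , (λ ()) , (λ ()) , (λ ()) , refl

  δ-no-step : ∀ {a u} → ¬ Step δₜ a u
  δ-no-step (() , _)

  δ-no-pred : ∀ {P} → ¬ Holds P δₜ
  δ-no-pred (() , _)

module Construction (nA nP : ℕ) (G : Preg.PregSystem nA nP) where
  open Preg nA nP
  open PregSystem G

  Code : Set
  Code = Σ (Fin nOps) (λ f → Fin (nRules f))

  codes : Listing Code
  codes = Σˡ (listFin nOps) (λ f → listFin (nRules f))

  -- Kept abstract: only the enumeration property is used, and unfolding the
  -- enumeration during type checking would be expensive.
  abstract
    ruleCount : ℕ
    ruleCount = Listing.count codes

    ruleAt : Fin ruleCount → Code
    ruleAt = Listing.nth codes

    ruleIndex : Code → Fin ruleCount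
    ruleIndex = Listing.position codes

    ruleAt-ruleIndex : ∀ c → ruleAt (ruleIndex c) ≡ c
    ruleAt-ruleIndex = Listing.nth-position codes

  ruleOf : (c : Code) → Rule (sigOf G) (arity (proj₁ c))
  ruleOf c = rules (proj₁ c) (proj₂ c)

  nArg nStep nPred nNoStep nNoPred : Code → ℕ
  nArg c = arity (proj₁ c)
  nStep c = Rule.kT (ruleOf c)
  nPred c = Rule.kP (ruleOf c)
  nNoStep c = Rule.kN (ruleOf c)
  nNoPred c = Rule.kQ (ruleOf c)

  -- The premises of a rule are its slots: every premise gets its own
  -- argument position in the auxiliary operation F_c, holding a copy of the
  -- argument that the premise tests.
  PosSlot NegSlot Slot Arg : Code → Set
  PosSlot c = Fin (nStep c) ⊎ Fin (nPred c)
  NegSlot c = Fin (nNoStep c) ⊎ Fin (nNoPred c)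
  Slot c = PosSlot c ⊎ NegSlot c
  Arg c = Fin (nArg c) ⊎ Slot c

  pattern step j = inj₁ j
  pattern pred j = inj₂ j
  pattern nostep j = inj₁ j
  pattern nopred j = inj₂ j
  pattern pos p = inj₁ p
  pattern neg n = inj₂ n
  pattern orig i = inj₁ i
  pattern prem s = inj₂ s

  _≟S_ : {c : Code} → DecidableEquality (Slot c)
  _≟S_ = ≡-dec (≡-dec _≟F_ _≟F_) (≡-dec _≟F_ _≟F_)

  stepAct : {c : Code} → Fin (nStep c) → Act
  stepAct {c} j = proj₂ (Rule.posT (ruleOf c) j)
  predOf : {c : Code} → Fin (nPred c) → Pred
  predOf {c} j = proj₂ (Rule.posP (ruleOf c) j)
  noStepAct : {c : Code} → Fin (nNoStep c) → Act
  noStepAct {c} j = proj₂ (Rule.negT (ruleOf c) j)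
  noPredOf : {c : Code} → Fin (nNoPred c) → Pred
  noPredOf {c} j = proj₂ (Rule.negP (ruleOf c) j)

  conclOf : (c : Code) → Concl (sigOf G) (Fin (nArg c) ⊎ Fin (nStep c))
  conclOf c = Rule.concl (ruleOf c)

  tested : {c : Code} → Slot c → Fin (nArg c)
  tested {c} (pos (step j)) = proj₁ (Rule.posT (ruleOf c) j)
  tested {c} (pos (pred j)) = proj₁ (Rule.posP (ruleOf c) j)
  tested {c} (neg (nostep j)) = proj₁ (Rule.negT (ruleOf c) j)
  tested {c} (neg (nopred j)) = proj₁ (Rule.negP (ruleOf c) j)

  argLayout : (c : Code) → Layout (Arg c)
  argLayout c = finLayout (nArg c) ⊎ᴸ ((finLayout (nStep c) ⊎ᴸ finLayout (nPred c))
                                    ⊎ᴸ (finLayout (nNoStep c) ⊎ᴸ finLayout (nNoPred c)))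

  arC : Code → ℕ
  arC c = Layout.size (argLayout c)

  module _ {c : Code} where
    open Layout (argLayout c)

    argView : Fin (arC c) → Arg c
    argView = decode

    origPos : Fin (nArg c) → Fin (arC c)
    origPos i = encode (orig i)

    slotPos : Slot c → Fin (arC c)
    slotPos s = encode (prem s)

    view-slotPos : (s : Slot c) → argView (slotPos s) ≡ prem s
    view-slotPos s = decode-encode (prem s)

    view-origPos : (i : Fin (nArg c)) → argView (origPos i) ≡ orig i
    view-origPos i = decode-encode (orig i)

    view⇒encode : ∀ {k a} → argView k ≡ a → k ≡ encode a
    view⇒encode = decode⇒encode

    origPos≢slotPos : ∀ i s → origPos i ≢ slotPos s
    origPos≢slotPos i s = encode-injective {orig i} {prem s} (λ ())

    slotPos-injective : ∀ {s s'} → s ≢ s' → slotPos s ≢ slotPos s'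
    slotPos-injective {s} {s'} s≢s' = encode-injective {prem s} {prem s'} (λ e → s≢s' (inj₂-injective e))

  SX : Sig
  SX = SigX G ruleCount (λ g → arC (ruleAt g))

  -- terms of G as terms of G′ (the embedding embT G X, available before X)
  emb : {V : Set} → Term (sigOf G) V → Term SX V
  emb (var x) = var x
  emb (app f ts) = app (inj₁ f) (λ i → emb (ts i))

  toArg : {c : Code} → Fin (nArg c) ⊎ Fin (nStep c) → Fin (arC c) ⊎ Fin (nStep c)
  toArg {c} (inj₁ i) = inj₁ (origPos {c} i)
  toArg (inj₂ j) = inj₂ j

  embConcl : {V : Set} → Concl (sigOf G) V → Concl SX V
  embConcl (transC a C) = transC a (emb C)
  embConcl (predC Q) = predC Q

  FConcl : (c : Code) → Concl (sigOf G) (Fin (nArg c) ⊎ Fin (nStep c)) → Concl SX (Fin (arC c) ⊎ Fin (nStep c))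
  FConcl c (transC a C) = transC a (emb C [ (λ v → var (toArg v)) ])
  FConcl c (predC Q) = predC Q

  FRule : (c : Code) → Rule SX (arC c)
  FRule c = record
    { kT = nStep c   ; posT = λ j → slotPos (pos (step j)) , stepAct j
    ; kP = nPred c   ; posP = λ j → slotPos (pos (pred j)) , predOf j
    ; kN = nNoStep c ; negT = λ j → slotPos (neg (nostep j)) , noStepAct j
    ; kQ = nNoPred c ; negP = λ j → slotPos (neg (nopred j)) , noPredOf j
    ; concl = FConcl c (conclOf c) }

  X : Extension G
  X = record { m = ruleCount ; arE = λ g → arC (ruleAt g) ; nrE = λ _ → 1 ; ruleE = λ g _ → FRule (ruleAt g) }

  open FTP nA nP G X public
  open Semantics (G' G X noImplicit) public

  F : {V : Set} (g : Fin ruleCount) → (Fin (arC (ruleAt g)) → Term SX V) → Term SX V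
  F g ts = app (inj₂ (inj₂ g)) ts

  when unless : {A : Set} → Dec A → Term SX ℕ → Term SX ℕ
  when (yes _) t = t
  when (no _) t = δₜ
  unless (yes _) t = δₜ
  unless (no _) t = t

  when-δ : {A : Set} (d : Dec A) {t : Term SX ℕ} → ¬ A → when d t ≡ δₜ
  when-δ (yes a) ¬a = ⊥-elim (¬a a)
  when-δ (no _) ¬a = refl

  -- Shapes of the argument in a positive slot that the axioms decompose:
  -- δ, x + y, a.x and κ_Q.  Together they bring the slot to a sum of good
  -- atoms a.x (a the premise's action) resp. κ_P (P the premise's predicate).
  data PosShape : Set where
    nil : PosShape
    sum : PosShape
    act : Act → PosShape
    con : Pred → PosShape

  -- Shapes of the argument in a negative slot: a.x + y and κ_Q + y.  They
  -- either kill F_c or drop the first summand, until the slot holds δ.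
  data NegShape : Set where
    act+ : Act → NegShape
    con+ : Pred → NegShape

  posShape : {V : Set} → PosShape → Term SX V → Term SX V → Term SX V
  posShape nil x y = δₜ
  posShape sum x y = x ⊕ y
  posShape (act a) x y = a · x
  posShape (con Q) x y = κₜ Q

  negHead : {V : Set} → NegShape → Term SX V → Term SX V
  negHead (act+ a) x = a · x
  negHead (con+ Q) x = κₜ Q

  negShape : {V : Set} → NegShape → Term SX V → Term SX V → Term SX V
  negShape k x y = negHead k x ⊕ y

  -- In the axioms for F_g, argument k is the variable k, and arC is fresh.
  base : (c : Code) → Fin (arC c) → Term SX ℕ
  base c k = var (toℕ k)

  fresh : Code → Term SX ℕ
  fresh c = var (arC c)

  slotVar : {c : Code} → Slot c → Term SX ℕ
  slotVar s = var (toℕ (slotPos s))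

  Fslot : (g : Fin ruleCount) → Slot (ruleAt g) → Term SX ℕ → Term SX ℕ
  Fslot g s t = F g (base (ruleAt g) ⟨ slotPos s ≔ t ⟩)

  posLHS : (g : Fin ruleCount) → PosSlot (ruleAt g) → PosShape → Term SX ℕ
  posLHS g p k = Fslot g (pos p) (posShape k (slotVar (pos p)) (fresh (ruleAt g)))

  posRHS : (g : Fin ruleCount) → PosSlot (ruleAt g) → PosShape → Term SX ℕ
  posRHS g p nil = δₜ
  posRHS g p sum = Fslot g (pos p) (slotVar (pos p)) ⊕ Fslot g (pos p) (fresh (ruleAt g))
  posRHS g (step j) (act a) = when (a ≟F stepAct j) (posLHS g (step j) (act a))
  posRHS g (pred j) (act a) = δₜ
  posRHS g (step j) (con Q) = δₜ
  posRHS g (pred j) (con Q) = when (Q ≟F predOf j) (posLHS g (pred j) (con Q))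

  negLHS : (g : Fin ruleCount) → NegSlot (ruleAt g) → NegShape → Term SX ℕ
  negLHS g n k = Fslot g (neg n) (negShape k (slotVar (neg n)) (fresh (ruleAt g)))

  negRHS : (g : Fin ruleCount) → NegSlot (ruleAt g) → NegShape → Term SX ℕ
  negRHS g (nostep j) (act+ a) = unless (a ≟F noStepAct j) (Fslot g (neg (nostep j)) (fresh (ruleAt g)))
  negRHS g (nostep j) (con+ Q) = Fslot g (neg (nostep j)) (fresh (ruleAt g))
  negRHS g (nopred j) (act+ a) = Fslot g (neg (nopred j)) (fresh (ruleAt g))
  negRHS g (nopred j) (con+ Q) = unless (Q ≟F noPredOf j) (Fslot g (neg (nopred j)) (fresh (ruleAt g)))

  -- the canonical arguments on which rule c fires: a.y in a transition
  -- slot, κ_P in a predicate slot, δ in a negative slot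
  goodAt : {c : Code} → Arg c → Term SX ℕ
  goodAt {c} (orig i) = var (toℕ (origPos {c} i))
  goodAt (prem (pos (step j))) = stepAct j · slotVar (pos (step j))
  goodAt (prem (pos (pred j))) = κₜ (predOf j)
  goodAt (prem (neg _)) = δₜ

  fireLHS : Fin ruleCount → Term SX ℕ
  fireLHS g = F g (λ k → goodAt (argView k))

  fireEnv : {c : Code} → Fin (nArg c) ⊎ Fin (nStep c) → Term SX ℕ
  fireEnv {c} (inj₁ i) = var (toℕ (origPos {c} i))
  fireEnv (inj₂ j) = slotVar (pos (step j))

  fireRHS : (c : Code) → Concl (sigOf G) (Fin (nArg c) ⊎ Fin (nStep c)) → Term SX ℕ
  fireRHS c (transC a C) = a · (emb C [ fireEnv ])
  fireRHS c (predC Q) = κₜ Q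

  expandAt : {c : Code} → Arg c → Term SX ℕ
  expandAt (orig i) = var (toℕ i)
  expandAt (prem s) = var (toℕ (tested s))

  sumₜ : {V : Set} → List (Term SX V) → Term SX V
  sumₜ [] = δₜ
  sumₜ (t ∷ ts) = t ⊕ sumₜ ts

  rulesFor : Fin nOps → List (Fin ruleCount)
  rulesFor f = filter (λ g → proj₁ (ruleAt g) ≟F f) (allFin ruleCount)

  summand : Fin ruleCount → Term SX ℕ
  summand g = F g (λ k → expandAt (argView k))

  expansion : Fin nOps → Term SX ℕ
  expansion f = sumₜ (map summand (rulesFor f))

  data AxiomName : Set where
    assoc unitˡ unitʳ : AxiomName
    expand : Fin nOps → AxiomName
    posAx  : (g : Fin ruleCount) → PosSlot (ruleAt g) → PosShape → AxiomName
    negAx  : (g : Fin ruleCount) → NegSlot (ruleAt g) → NegShape → AxiomName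
    fire   : Fin ruleCount → AxiomName

  axiomEqn : AxiomName → Eqn SX
  axiomEqn assoc = (var 0 ⊕ var 1) ⊕ var 2 , var 0 ⊕ (var 1 ⊕ var 2)
  axiomEqn unitˡ = δₜ ⊕ var 0 , var 0
  axiomEqn unitʳ = var 0 ⊕ δₜ , var 0
  axiomEqn (expand f) = app (inj₁ f) (λ i → var (toℕ i)) , expansion f
  axiomEqn (posAx g p k) = posLHS g p k , posRHS g p k
  axiomEqn (negAx g n k) = negLHS g n k , negRHS g n k
  axiomEqn (fire g) = fireLHS g , fireRHS (ruleAt g) (conclOf (ruleAt g))

  posShapes : Listing PosShape
  posShapes = record
    { list = nil ∷ sum ∷ acts ++ cons
    ; complete = λ { nil → here refl ; sum → there (here refl)
                   ; (act a) → there (there (∈-++⁺ˡ {ys = cons} (∈-map⁺ act (∈-allFin a))))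
                   ; (con Q) → there (there (∈-++⁺ʳ acts (∈-map⁺ con (∈-allFin Q)))) } }
    where
    acts cons : List PosShape
    acts = map act (allFin _)
    cons = map con (allFin _)

  negShapes : Listing NegShape
  negShapes = record
    { list = acts ++ cons
    ; complete = λ { (act+ a) → ∈-++⁺ˡ {ys = cons} (∈-map⁺ act+ (∈-allFin a))
                   ; (con+ Q) → ∈-++⁺ʳ acts (∈-map⁺ con+ (∈-allFin Q)) } }
    where
    acts cons : List NegShape
    acts = map act+ (allFin _)
    cons = map con+ (allFin _)

  axiomNames : Listing AxiomName
  axiomNames = record
    { list = assoc ∷ unitˡ ∷ unitʳ ∷ expands ++ (poss ++ (negs ++ fires))
    ; complete = λ
        { assoc → here refl ; unitˡ → there (here refl) ; unitʳ → there (there (here refl))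
        ; (expand f) → there (there (there (∈-++⁺ˡ {ys = poss ++ (negs ++ fires)} (∈-map⁺ expand (∈-allFin f)))))
        ; (posAx g p k) → there (there (there (∈-++⁺ʳ expands (∈-++⁺ˡ {ys = negs ++ fires}
            (∈-map⁺ posAx′ (complete posL (g , p , k)))))))
        ; (negAx g n k) → there (there (there (∈-++⁺ʳ expands (∈-++⁺ʳ poss (∈-++⁺ˡ {ys = fires}
            (∈-map⁺ negAx′ (complete negL (g , n , k))))))))
        ; (fire g) → there (there (there (∈-++⁺ʳ expands (∈-++⁺ʳ poss (∈-++⁺ʳ negs
            (∈-map⁺ fire (∈-allFin g))))))) } }
    where
    open Listing
    posL : Listing (Σ (Fin ruleCount) λ g → PosSlot (ruleAt g) × PosShape)
    posL = Σˡ (listFin _) (λ g → Σˡ (listFin _ ⊎ˡ listFin _) (λ _ → posShapes))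
    negL : Listing (Σ (Fin ruleCount) λ g → NegSlot (ruleAt g) × NegShape)
    negL = Σˡ (listFin _) (λ g → Σˡ (listFin _ ⊎ˡ listFin _) (λ _ → negShapes))
    posAx′ : (Σ (Fin ruleCount) λ g → PosSlot (ruleAt g) × PosShape) → AxiomName
    posAx′ (g , p , k) = posAx g p k
    negAx′ : (Σ (Fin ruleCount) λ g → NegSlot (ruleAt g) × NegShape) → AxiomName
    negAx′ (g , n , k) = negAx g n k
    expands poss negs fires : List AxiomName
    expands = map expand (allFin nOps)
    poss = map posAx′ (list posL)
    negs = map negAx′ (list negL)
    fires = map fire (allFin ruleCount)

  E : AxiomSystem SX
  E = axiomsFrom axiomNames axiomEqn

  Meets : {c : Code} → Slot c → CT → (Fin (nStep c) → CT) → Set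
  Meets (pos (step j)) t ys = Step t (stepAct j) (ys j)
  Meets (pos (pred j)) t ys = Holds (predOf j) t
  Meets (neg (nostep j)) t ys = ∀ v → ¬ Step t (noStepAct j) v
  Meets (neg (nopred j)) t ys = ¬ Holds (noPredOf j) t

  Premises : (c : Code) → (Fin (arC c) → CT) → (Fin (nStep c) → CT) → Set
  Premises c ts ys = ∀ s → Meets s (ts (slotPos s)) ys

  Fconcl : (c : Code) → Concl SX (Fin (arC c) ⊎ Fin (nStep c))
  Fconcl c = FConcl c (conclOf c)

  FStep : (c : Code) → (Fin (arC c) → CT) → Act → CT → Set
  FStep c ts a u = Σ (Fin (nStep c) → CT) λ ys → Premises c ts ys × TrConcl (Fconcl c) a (env ts ys) u

  FHolds : (c : Code) → (Fin (arC c) → CT) → Pred → Set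
  FHolds c ts P = Σ (Fin (nStep c) → CT) λ ys → Premises c ts ys × PrConcl (Fconcl c) P

  F-step-inv : ∀ g ts {a u} → Step (F g ts) a u → FStep (ruleAt g) ts a u
  F-step-inv g ts (_ , ys , pT , pP , nT , nQ , tc) =
    ys , (λ { (pos (step j)) → pT j ; (pos (pred j)) → pP j ; (neg (nostep j)) → nT j ; (neg (nopred j)) → nQ j }) , tc

  F-step : ∀ g ts {a u} → FStep (ruleAt g) ts a u → Step (F g ts) a u
  F-step g ts (ys , ok , tc) =
    zero , ys , (λ j → ok (pos (step j))) , (λ j → ok (pos (pred j))) , (λ j → ok (neg (nostep j))) , (λ j → ok (neg (nopred j))) , tc

  F-holds-inv : ∀ g ts {P} → Holds P (F g ts) → FHolds (ruleAt g) ts P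
  F-holds-inv g ts (_ , ys , pT , pP , nT , nQ , pc) =
    ys , (λ { (pos (step j)) → pT j ; (pos (pred j)) → pP j ; (neg (nostep j)) → nT j ; (neg (nopred j)) → nQ j }) , pc

  F-holds : ∀ g ts {P} → FHolds (ruleAt g) ts P → Holds P (F g ts)
  F-holds g ts (ys , ok , pc) =
    zero , ys , (λ j → ok (pos (step j))) , (λ j → ok (pos (pred j))) , (λ j → ok (neg (nostep j))) , (λ j → ok (neg (nopred j))) , pc

  FConcl→ : {c : Code} (cc : Concl (sigOf G) (Fin (nArg c) ⊎ Fin (nStep c))) {a : Act} {σ : Fin (arC c) ⊎ Fin (nStep c) → CT} {u : CT} →
            TrConcl (FConcl c cc) a σ u → TrConcl (embConcl cc) a (λ v → σ (toArg v)) u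
  FConcl→ (transC b C) {σ = σ} (b≡a , q) = b≡a , ≈-trans (≈-sym (subst-comp (emb C) _ σ)) q
  FConcl→ (predC _) ()

  →FConcl : {c : Code} (cc : Concl (sigOf G) (Fin (nArg c) ⊎ Fin (nStep c))) {a : Act} {σ : Fin (arC c) ⊎ Fin (nStep c) → CT} {u : CT} →
            TrConcl (embConcl cc) a (λ v → σ (toArg v)) u → TrConcl (FConcl c cc) a σ u
  →FConcl (transC b C) {σ = σ} (b≡a , q) = b≡a , ≈-trans (subst-comp (emb C) _ σ) q
  →FConcl (predC _) ()

  emb≈ : {V : Set} (C : Term (sigOf G) V) → embT G X C ≈ₜ emb C
  emb≈ (var x) = var≈ x
  emb≈ (app f ts) = app≈ (inj₁ f) _ _ (λ i → emb≈ (ts i))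

  embC⇒ : {V : Set} (cc : Concl (sigOf G) V) {a : Act} {σ : V → CT} {u : CT} →
          TrConcl (embC G X cc) a σ u → TrConcl (embConcl cc) a σ u
  embC⇒ (transC b C) {σ = σ} (b≡a , q) = b≡a , ≈-trans (≈-subst σ (≈-sym (emb≈ C))) q
  embC⇒ (predC _) ()

  ⇒embC : {V : Set} (cc : Concl (sigOf G) V) {a : Act} {σ : V → CT} {u : CT} →
          TrConcl (embConcl cc) a σ u → TrConcl (embC G X cc) a σ u
  ⇒embC (transC b C) {σ = σ} (b≡a , q) = b≡a , ≈-trans (≈-subst σ (emb≈ C)) q
  ⇒embC (predC _) ()

  FConcl-pred : {c : Code} (cc : Concl (sigOf G) (Fin (nArg c) ⊎ Fin (nStep c))) {P : Pred} →
                PrConcl (FConcl c cc) P ≡ PrConcl (embC G X cc) P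
  FConcl-pred (transC _ _) = refl
  FConcl-pred (predC _) = refl

  Fconcl-orig : {c : Code} {ts us : Fin (arC c) → CT} {ys : Fin (nStep c) → CT} {a : Act} {u : CT} →
                (∀ i → ts (origPos i) ≡ us (origPos i)) →
                TrConcl (Fconcl c) a (env ts ys) u → TrConcl (Fconcl c) a (env us ys) u
  Fconcl-orig {c} {ts} {us} {ys} agree tc =
    →FConcl (conclOf c) (TrConcl-env (embConcl (conclOf c)) same (FConcl→ (conclOf c) tc))
    where
    same : ∀ v → env us ys (toArg v) ≈ₜ env ts ys (toArg v)
    same (inj₁ i) = ≡⇒≈ (≡.sym (agree i))
    same (inj₂ j) = ≈-refl _

  open Transfer nA nP (G' G X noImplicit) E hiding (CT)

  module Fill (g : Fin ruleCount) (ts : Fin (arC (ruleAt g)) → CT) (s : Slot (ruleAt g)) where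

    filled : CT → Fin (arC (ruleAt g)) → CT
    filled t = ts ⟨ slotPos s ≔ t ⟩

    meets-filled : ∀ {t ys} → Premises (ruleAt g) (filled t) ys → Meets s t ys
    meets-filled {t} {ys} ok = ≡.subst (λ z → Meets s z ys) (≔-same ts (slotPos s) t) (ok s)

    premises-filled : ∀ {t t' ys} → (Meets s t ys → Meets s t' ys) →
                      Premises (ruleAt g) (filled t) ys → Premises (ruleAt g) (filled t') ys
    premises-filled {t} {t'} {ys} f ok s' with s' ≟S s
    ... | yes refl = ≡.subst (λ z → Meets s z ys) (≡.sym (≔-same ts (slotPos s) t')) (f (meets-filled ok))
    ... | no s'≢s = ≡.subst (λ z → Meets s' z ys) (≡.trans (≔-other ts t s'≢s′) (≡.sym (≔-other ts t' s'≢s′))) (ok s')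
      where
      s'≢s′ : slotPos s' ≢ slotPos s
      s'≢s′ = slotPos-injective s'≢s

    orig-filled : ∀ t t' i → filled t (origPos i) ≡ filled t' (origPos i)
    orig-filled t t' i = ≡.trans (≔-other ts t (origPos≢slotPos i s)) (≡.sym (≔-other ts t' (origPos≢slotPos i s)))

    refill-step : ∀ {t t' a u} (fs : FStep (ruleAt g) (filled t) a u) → Meets s t' (proj₁ fs) → Step (F g (filled t')) a u
    refill-step {t} {t'} (ys , ok , tc) m =
      F-step g (filled t') (ys , premises-filled (λ _ → m) ok , Fconcl-orig (orig-filled t t') tc)

    refill-holds : ∀ {t t' P} (fh : FHolds (ruleAt g) (filled t) P) → Meets s t' (proj₁ fh) → Holds P (F g (filled t'))
    refill-holds {t} {t'} (ys , ok , pc) m = F-holds g (filled t') (ys , premises-filled (λ _ → m) ok , pc)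

    fill-step : ∀ {t t'} → (∀ ys → Meets s t ys → Meets s t' ys) →
                ∀ {a u} → Step (F g (filled t)) a u → Step (F g (filled t')) a u
    fill-step {t} f st = let fs = F-step-inv g (filled t) st in refill-step fs (f _ (meets-filled (proj₁ (proj₂ fs))))

    fill-holds : ∀ {t t'} → (∀ ys → Meets s t ys → Meets s t' ys) →
                 ∀ {P} → Holds P (F g (filled t)) → Holds P (F g (filled t'))
    fill-holds {t} f h = let fh = F-holds-inv g (filled t) h in refill-holds fh (f _ (meets-filled (proj₁ (proj₂ fh))))

    fill-⇄ : ∀ {t t'} → (∀ ys → Meets s t ys → Meets s t' ys) → (∀ ys → Meets s t' ys → Meets s t ys) →
             F g (filled t) ⇄ F g (filled t')
    fill-⇄ f b = mirror-⇄ (fill-step f) (fill-step b) (fill-holds f) (fill-holds b)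

    fill-inert : ∀ {t} → (∀ ys → ¬ Meets s t ys) → Inert (F g (filled t))
    fill-inert {t} ¬m = (λ a u st → let (ys , ok , _) = F-step-inv g (filled t) st in ¬m ys (meets-filled ok))
                      , (λ P h → let (ys , ok , _) = F-holds-inv g (filled t) h in ¬m ys (meets-filled ok))

    fill-⊕-⇄ : ∀ {x y} → (∀ ys → Meets s (x ⊕ y) ys → Meets s x ys ⊎ Meets s y ys) →
               (∀ ys → Meets s x ys ⊎ Meets s y ys → Meets s (x ⊕ y) ys) →
               F g (filled (x ⊕ y)) ⇄ F g (filled x) ⊕ F g (filled y)
    fill-⊕-⇄ {x} {y} split join = mirror-⇄ split-step join-step split-holds join-holds
      where
      F+ : CT
      F+ = F g (filled x) ⊕ F g (filled y)
      split-step : ∀ {a u} → Step (F g (filled (x ⊕ y))) a u → Step F+ a u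
      split-step st with F-step-inv g (filled (x ⊕ y)) st
      ... | fs@(ys , ok , _) with split ys (meets-filled ok)
      ...   | inj₁ m = ⊕-stepˡ _ (refill-step fs m)
      ...   | inj₂ m = ⊕-stepʳ _ (refill-step fs m)
      split-holds : ∀ {P} → Holds P (F g (filled (x ⊕ y))) → Holds P F+
      split-holds h with F-holds-inv g (filled (x ⊕ y)) h
      ... | fh@(ys , ok , _) with split ys (meets-filled ok)
      ...   | inj₁ m = ⊕-holdsˡ (pair (F g (filled x)) (F g (filled y))) (refill-holds fh m)
      ...   | inj₂ m = ⊕-holdsʳ (pair (F g (filled x)) (F g (filled y))) (refill-holds fh m)
      join-step : ∀ {a u} → Step F+ a u → Step (F g (filled (x ⊕ y))) a u
      join-step st with ⊕-step-inv (pair (F g (filled x)) (F g (filled y))) st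
      ... | inj₁ st′ = fill-step (λ ys m → join ys (inj₁ m)) st′
      ... | inj₂ st′ = fill-step (λ ys m → join ys (inj₂ m)) st′
      join-holds : ∀ {P} → Holds P F+ → Holds P (F g (filled (x ⊕ y)))
      join-holds h with ⊕-holds-inv (pair (F g (filled x)) (F g (filled y))) h
      ... | inj₁ h′ = fill-holds (λ ys m → join ys (inj₁ m)) h′
      ... | inj₂ h′ = fill-holds (λ ys m → join ys (inj₂ m)) h′

  δ-inert : Inert δₜ
  δ-inert = (λ a u → δ-no-step) , (λ P → δ-no-pred)

  δ-fails : ∀ {c} (p : PosSlot c) {ys} → ¬ Meets (pos p) δₜ ys
  δ-fails (step j) = δ-no-step
  δ-fails (pred j) = δ-no-pred

  ⊕-meets-inv : ∀ {c} (p : PosSlot c) {x y ys} → Meets (pos p) (x ⊕ y) ys → Meets (pos p) x ys ⊎ Meets (pos p) y ys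
  ⊕-meets-inv (step j) {x} {y} = ⊕-step-inv (pair x y)
  ⊕-meets-inv (pred j) {x} {y} = ⊕-holds-inv (pair x y)

  ⊕-meets : ∀ {c} (p : PosSlot c) {x y ys} → Meets (pos p) x ys ⊎ Meets (pos p) y ys → Meets (pos p) (x ⊕ y) ys
  ⊕-meets (step j) {x} {y} (inj₁ m) = ⊕-stepˡ (pair x y) m
  ⊕-meets (step j) {x} {y} (inj₂ m) = ⊕-stepʳ (pair x y) m
  ⊕-meets (pred j) {x} {y} (inj₁ m) = ⊕-holdsˡ (pair x y) m
  ⊕-meets (pred j) {x} {y} (inj₂ m) = ⊕-holdsʳ (pair x y) m

  ⊕-meets-neg : ∀ {c} (n : NegSlot c) {z y ys} → Meets (neg n) z ys → Meets (neg n) y ys → Meets (neg n) (z ⊕ y) ys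
  ⊕-meets-neg (nostep j) {z} {y} mz my v st = [ mz v , my v ]′ (⊕-step-inv (pair z y) st)
  ⊕-meets-neg (nopred j) {z} {y} mz my h = [ mz , my ]′ (⊕-holds-inv (pair z y) h)

  ⊕-meets-negʳ : ∀ {c} (n : NegSlot c) {z y ys} → Meets (neg n) (z ⊕ y) ys → Meets (neg n) y ys
  ⊕-meets-negʳ (nostep j) {z} {y} m v st = m v (⊕-stepʳ (pair z y) st)
  ⊕-meets-negʳ (nopred j) {z} {y} m h = m (⊕-holdsʳ (pair z y) h)

  sum-step-inv : ∀ (ts : List (Term SX ℕ)) {σ : ℕ → CT} {a u} → Step (sumₜ ts [ σ ]) a u →
                 Σ (Term SX ℕ) λ t → t ∈ ts × Step (t [ σ ]) a u
  sum-step-inv [] (() , _)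
  sum-step-inv (t ∷ ts) {σ} st with ⊕-step-inv (λ i → pair t (sumₜ ts) i [ σ ]) st
  ... | inj₁ st′ = t , here refl , st′
  ... | inj₂ st′ = let (t′ , t′∈ts , st″) = sum-step-inv ts st′ in t′ , there t′∈ts , st″

  sum-step : ∀ {ts t} {σ : ℕ → CT} {a u} → t ∈ ts → Step (t [ σ ]) a u → Step (sumₜ ts [ σ ]) a u
  sum-step {t′ ∷ ts} {σ = σ} (here refl) st = ⊕-stepˡ (λ i → pair t′ (sumₜ ts) i [ σ ]) st
  sum-step {t′ ∷ ts} {σ = σ} (there t∈ts) st = ⊕-stepʳ (λ i → pair t′ (sumₜ ts) i [ σ ]) (sum-step t∈ts st)

  sum-holds-inv : ∀ (ts : List (Term SX ℕ)) {σ : ℕ → CT} {P} → Holds P (sumₜ ts [ σ ]) →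
                  Σ (Term SX ℕ) λ t → t ∈ ts × Holds P (t [ σ ])
  sum-holds-inv [] (() , _)
  sum-holds-inv (t ∷ ts) {σ} h with ⊕-holds-inv (λ i → pair t (sumₜ ts) i [ σ ]) h
  ... | inj₁ h′ = t , here refl , h′
  ... | inj₂ h′ = let (t′ , t′∈ts , h″) = sum-holds-inv ts h′ in t′ , there t′∈ts , h″

  sum-holds : ∀ {ts t} {σ : ℕ → CT} {P} → t ∈ ts → Holds P (t [ σ ]) → Holds P (sumₜ ts [ σ ])
  sum-holds {t′ ∷ ts} {σ = σ} (here refl) h = ⊕-holdsˡ (λ i → pair t′ (sumₜ ts) i [ σ ]) h
  sum-holds {t′ ∷ ts} {σ = σ} (there t∈ts) h = ⊕-holdsʳ (λ i → pair t′ (sumₜ ts) i [ σ ]) (sum-holds t∈ts h)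

  assoc-⇄ : (x y z : CT) → (x ⊕ y) ⊕ z ⇄ x ⊕ (y ⊕ z)
  assoc-⇄ x y z = mirror-⇄
    ([ [ ⊕-stepˡ r , ⊕-stepʳ r ∘ ⊕-stepˡ yz ]′ ∘ ⊕-step-inv xy , ⊕-stepʳ r ∘ ⊕-stepʳ yz ]′ ∘ ⊕-step-inv l)
    ([ ⊕-stepˡ l ∘ ⊕-stepˡ xy , [ ⊕-stepˡ l ∘ ⊕-stepʳ xy , ⊕-stepʳ l ]′ ∘ ⊕-step-inv yz ]′ ∘ ⊕-step-inv r)
    ([ [ ⊕-holdsˡ r , ⊕-holdsʳ r ∘ ⊕-holdsˡ yz ]′ ∘ ⊕-holds-inv xy , ⊕-holdsʳ r ∘ ⊕-holdsʳ yz ]′ ∘ ⊕-holds-inv l)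
    ([ ⊕-holdsˡ l ∘ ⊕-holdsˡ xy , [ ⊕-holdsˡ l ∘ ⊕-holdsʳ xy , ⊕-holdsʳ l ]′ ∘ ⊕-holds-inv yz ]′ ∘ ⊕-holds-inv r)
    where
    xy yz l r : Fin 2 → CT
    xy = pair x y
    yz = pair y z
    l = pair (x ⊕ y) z
    r = pair x (y ⊕ z)

  unitˡ-⇄ : (x : CT) → δₜ ⊕ x ⇄ x
  unitˡ-⇄ x = mirror-⇄ ([ ⊥-elim ∘ δ-no-step , id ]′ ∘ ⊕-step-inv (pair δₜ x)) (⊕-stepʳ (pair δₜ x))
                       ([ ⊥-elim ∘ δ-no-pred , id ]′ ∘ ⊕-holds-inv (pair δₜ x)) (⊕-holdsʳ (pair δₜ x))

  unitʳ-⇄ : (x : CT) → x ⊕ δₜ ⇄ x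
  unitʳ-⇄ x = mirror-⇄ ([ id , ⊥-elim ∘ δ-no-step ]′ ∘ ⊕-step-inv (pair x δₜ)) (⊕-stepˡ (pair x δₜ))
                       ([ id , ⊥-elim ∘ δ-no-pred ]′ ∘ ⊕-holds-inv (pair x δₜ)) (⊕-holdsˡ (pair x δₜ))

  δ-inst : {V : Set} (σ : V → CT) → (δₜ [ σ ]) ≈ₜ δₜ
  δ-inst σ = app≈ _ _ _ (λ ())

  κ-inst : {V : Set} (Q : Pred) (σ : V → CT) → (κₜ Q [ σ ]) ≈ₜ κₜ Q
  κ-inst Q σ = app≈ _ _ _ (λ ())

  ⊕-≈ : {t t' u u' : CT} → t ≈ₜ t' → u ≈ₜ u' → (t ⊕ u) ≈ₜ (t' ⊕ u')
  ⊕-≈ e e' = app≈ _ _ _ (λ { zero → e ; (suc zero) → e' })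

  ⊕-inst : {V : Set} (t u : Term SX V) (σ : V → CT) → ((t ⊕ u) [ σ ]) ≈ₜ ((t [ σ ]) ⊕ (u [ σ ]))
  ⊕-inst t u σ = app≈ _ _ _ (λ { zero → ≈-refl _ ; (suc zero) → ≈-refl _ })

  posShape-inst : {V : Set} (k : PosShape) (x y : Term SX V) (σ : V → CT) →
                  (posShape k x y [ σ ]) ≈ₜ posShape k (x [ σ ]) (y [ σ ])
  posShape-inst nil x y σ = δ-inst σ
  posShape-inst sum x y σ = ⊕-inst x y σ
  posShape-inst (act a) x y σ = ≈-refl _
  posShape-inst (con Q) x y σ = κ-inst Q σ

  negShape-inst : {V : Set} (k : NegShape) (x y : Term SX V) (σ : V → CT) →
                  (negShape k x y [ σ ]) ≈ₜ negShape k (x [ σ ]) (y [ σ ])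
  negShape-inst (act+ a) x y σ = ⊕-inst _ y σ
  negShape-inst (con+ Q) x y σ = ≈-trans (⊕-inst _ y σ) (⊕-≈ (κ-inst Q σ) (≈-refl _))

  module AxiomSoundness (σ : ℕ → CT) where

    args : (g : Fin ruleCount) → Fin (arC (ruleAt g)) → CT
    args g k = σ (toℕ k)

    Fσ : (g : Fin ruleCount) → Slot (ruleAt g) → CT → CT
    Fσ g s t = F g (Fill.filled g (args g) s t)

    Fslot-inst : ∀ g s T {t} → (T [ σ ]) ≈ₜ t → (Fslot g s T [ σ ]) ≈ₜ Fσ g s t
    Fslot-inst g s T e = app≈ _ _ _ (λ k →
      ≈-trans (≡⇒≈ (≔-map (_[ σ ]) (base (ruleAt g)) (slotPos s) T k)) (≔-cong _≈ₜ_ ≈-refl (args g) (slotPos s) e k))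

    δσ-inert : Inert (δₜ [ σ ])
    δσ-inert = ≈-inert (δ-inst σ) δ-inert

    killed : ∀ g s {T t} → (T [ σ ]) ≈ₜ t → (∀ ys → ¬ Meets s t ys) → (Fslot g s T [ σ ]) ⇄ (δₜ [ σ ])
    killed g s e ¬m = ⇄-resp (Fslot-inst g s _ e) (inert-⇄ (Fill.fill-inert g (args g) s ¬m) δ-inert) (δ-inst σ)

    pos-⇄ : ∀ g p k → (posLHS g p k [ σ ]) ⇄ (posRHS g p k [ σ ])
    pos-⇄ g p nil = killed g (pos p) (δ-inst σ) (λ ys → δ-fails p)
    pos-⇄ g p sum =
      ⇄-resp (Fslot-inst g (pos p) _ (⊕-inst _ _ σ))
             (Fill.fill-⊕-⇄ g (args g) (pos p) (λ ys → ⊕-meets-inv p) (λ ys → ⊕-meets p))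
             (≈-trans (⊕-inst _ _ σ) (⊕-≈ (Fslot-inst g (pos p) _ (≈-refl _)) (Fslot-inst g (pos p) _ (≈-refl _))))
    pos-⇄ g (step j) (act a) with a ≟F stepAct j
    ... | yes _ = ⇄-refl _
    ... | no a≢ = killed g (pos (step j)) (≈-refl _) (λ ys st → a≢ (proj₁ (·-step-inv a _ st)))
    pos-⇄ g (pred j) (act a) = killed g (pos (pred j)) (≈-refl _) (λ ys → ·-no-pred a _)
    pos-⇄ g (step j) (con Q) = killed g (pos (step j)) (κ-inst Q σ) (λ ys → κ-no-step Q {stepAct j} {ys j})
    pos-⇄ g (pred j) (con Q) with Q ≟F predOf j
    ... | yes _ = ⇄-refl _
    ... | no Q≢ = killed g (pos (pred j)) (κ-inst Q σ) (λ ys h → Q≢ (κ-holds-inv Q h))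

    dropped : ∀ g n k → (∀ ys → Meets (neg n) (negHead k (slotVar (neg n) [ σ ])) ys) →
              (negLHS g n k [ σ ]) ⇄ (Fslot g (neg n) (fresh (ruleAt g)) [ σ ])
    dropped g n k harmless =
      ⇄-resp (Fslot-inst g (neg n) _ (negShape-inst k _ _ σ))
             (Fill.fill-⇄ g (args g) (neg n) (λ ys → ⊕-meets-negʳ n) (λ ys → ⊕-meets-neg n (harmless ys)))
             (Fslot-inst g (neg n) _ (≈-refl _))

    neg-⇄ : ∀ g n k → (negLHS g n k [ σ ]) ⇄ (negRHS g n k [ σ ])
    neg-⇄ g (nostep j) (act+ a) with a ≟F noStepAct j
    ... | yes refl = killed g (neg (nostep j)) (negShape-inst (act+ a) _ _ σ) (λ ys m → m _ (⊕-stepˡ (pair (a · _) _) ·-step))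
    ... | no a≢ = dropped g (nostep j) (act+ a) (λ ys v st → a≢ (proj₁ (·-step-inv a _ st)))
    neg-⇄ g (nostep j) (con+ Q) = dropped g (nostep j) (con+ Q) (λ ys v → κ-no-step Q {noStepAct j} {v})
    neg-⇄ g (nopred j) (act+ a) = dropped g (nopred j) (act+ a) (λ ys → ·-no-pred a _)
    neg-⇄ g (nopred j) (con+ Q) with Q ≟F noPredOf j
    ... | yes refl = killed g (neg (nopred j)) (negShape-inst (con+ Q) (slotVar (neg (nopred j))) (fresh (ruleAt g)) σ) (λ ys m → m (⊕-holdsˡ (pair (κₜ Q) (σ (arC (ruleAt g)))) (κ-holds Q)))
    ... | no Q≢ = dropped g (nopred j) (con+ Q) (λ ys h → Q≢ (κ-holds-inv Q h))

    module Fire (g : Fin ruleCount) where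

      c : Code
      c = ruleAt g

      good : Fin (arC c) → CT
      good k = goodAt (argView k) [ σ ]

      target : Fin (nStep c) → CT
      target j = σ (toℕ (slotPos {c} (pos (step j))))

      good-slot : ∀ s → good (slotPos s) ≡ (goodAt (prem s) [ σ ])
      good-slot s = ≡.cong (λ a → goodAt a [ σ ]) (view-slotPos s)

      good-orig : ∀ i → good (origPos i) ≡ σ (toℕ (origPos {c} i))
      good-orig i = ≡.cong (λ a → goodAt a [ σ ]) (view-origPos i)

      good-premises : Premises c good target
      good-premises s@(pos (step j)) = ≡.subst (λ t → Step t (stepAct j) (target j)) (≡.sym (good-slot s)) ·-step
      good-premises s@(pos (pred j)) = ≡.subst (Holds (predOf j)) (≡.sym (good-slot s)) (≈-holds (≈-sym (κ-inst _ σ)) (κ-holds (predOf j)))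
      good-premises s@(neg (nostep j)) v st = proj₁ δσ-inert _ v (≡.subst (λ t → Step t (noStepAct j) v) (good-slot s) st)
      good-premises s@(neg (nopred j)) h = proj₂ δσ-inert _ (≡.subst (Holds (noPredOf j)) (good-slot s) h)

      fired-env : ∀ {ys} → Premises c good ys → ∀ v → env good ys (toArg v) ≈ₜ (fireEnv v [ σ ])
      fired-env ok (inj₁ i) = ≡⇒≈ (good-orig i)
      fired-env {ys} ok (inj₂ j) =
        ≈-sym (proj₂ (·-step-inv _ _ (≡.subst (λ t → Step t (stepAct j) (ys j)) (good-slot (pos (step j))) (ok (pos (step j))))))

      fire-forth : ∀ cc {ys a u} → Premises c good ys → TrConcl (FConcl c cc) a (env good ys) u →
                   Σ CT λ u' → Step (fireRHS c cc [ σ ]) a u' × u ≃ᴱ u'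
      fire-forth (transC b C) ok tc with FConcl→ (transC b C) tc
      ... | refl , q = (emb C [ fireEnv ]) [ σ ] , ·-step ,
                       ≈⇒≃ (≈-trans (≈-sym q) (≈-trans (subst-cong (emb C) (fired-env ok)) (≈-sym (subst-comp (emb C) fireEnv σ))))
      fire-forth (predC Q) ok ()

      fire-back : ∀ cc {a u} → Step (fireRHS c cc [ σ ]) a u → TrConcl (FConcl c cc) a (env good target) u
      fire-back (transC b C) st with ·-step-inv b _ st
      ... | b≡a , q = →FConcl (transC b C)
            (b≡a , ≈-trans (subst-cong (emb C) (fired-env good-premises)) (≈-trans (≈-sym (subst-comp (emb C) fireEnv σ)) q))
      fire-back (predC Q) (_ , _ , _ , _ , _ , _ , ())

      fire-pred-forth : ∀ cc {P} → PrConcl (FConcl c cc) P → Holds P (fireRHS c cc [ σ ])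
      fire-pred-forth (transC _ _) ()
      fire-pred-forth (predC Q) refl = ≈-holds (≈-sym (κ-inst Q σ)) (κ-holds Q)

      fire-pred-back : ∀ cc {P} → Holds P (fireRHS c cc [ σ ]) → PrConcl (FConcl c cc) P
      fire-pred-back (transC b C) h = ⊥-elim (·-no-pred b _ h)
      fire-pred-back (predC Q) (_ , _ , _ , _ , _ , _ , Q≡P) = Q≡P

      fire-⇄ : (fireLHS g [ σ ]) ⇄ (fireRHS c (conclOf c) [ σ ])
      fire-⇄ = record
        { forth = λ a u st → let (ys , ok , tc) = F-step-inv g good st in fire-forth cc ok tc
        ; back = λ a u st → u , F-step g good (target , good-premises , fire-back cc st) , ≃refl u
        ; pred-forth = λ P h → let (_ , _ , pc) = F-holds-inv g good h in fire-pred-forth cc pc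
        ; pred-back = λ P h → F-holds g good (target , good-premises , fire-pred-back cc h) }
        where
        cc : Concl (sigOf G) (Fin (nArg c) ⊎ Fin (nStep c))
        cc = conclOf c

    module Expand where

      xs : (f : Fin nOps) → Fin (arity f) → CT
      xs f i = σ (toℕ i)

      copies : (c : Code) → Fin (arC c) → CT
      copies c k = expandAt {c} (argView k) [ σ ]

      copies-slot : ∀ c s → copies c (slotPos s) ≡ σ (toℕ (tested s))
      copies-slot c s = ≡.cong (λ a → expandAt a [ σ ]) (view-slotPos s)

      copies-orig : ∀ c i → copies c (origPos i) ≡ σ (toℕ i)
      copies-orig c i = ≡.cong (λ a → expandAt a [ σ ]) (view-origPos i)

      GPremises : (c : Code) → (Fin (nStep c) → CT) → Set
      GPremises c ys = ∀ s → Meets s (σ (toℕ (tested s))) ys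

      copies-premises : ∀ c {ys} → Premises c (copies c) ys → GPremises c ys
      copies-premises c {ys} ok s = ≡.subst (λ t → Meets s t ys) (copies-slot c s) (ok s)

      premises-copies : ∀ c {ys} → GPremises c ys → Premises c (copies c) ys
      premises-copies c {ys} ok s = ≡.subst (λ t → Meets s t ys) (≡.sym (copies-slot c s)) (ok s)

      copies-env : ∀ c {ys} v → env (copies c) ys (toArg v) ≈ₜ env (xs (proj₁ c)) ys v
      copies-env c (inj₁ i) = ≡⇒≈ (copies-orig c i)
      copies-env c (inj₂ j) = ≈-refl _

      concl-copies : ∀ c {ys a u} → TrConcl (embC G X (conclOf c)) a (env (xs (proj₁ c)) ys) u →
                     TrConcl (Fconcl c) a (env (copies c) ys) u
      concl-copies c tc = →FConcl (conclOf c) (TrConcl-env (embConcl (conclOf c)) (copies-env c) (embC⇒ (conclOf c) tc))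

      copies-concl : ∀ c {ys a u} → TrConcl (Fconcl c) a (env (copies c) ys) u →
                     TrConcl (embC G X (conclOf c)) a (env (xs (proj₁ c)) ys) u
      copies-concl c tc =
        ⇒embC (conclOf c) (TrConcl-env (embConcl (conclOf c)) (λ v → ≈-sym (copies-env c v)) (FConcl→ (conclOf c) tc))

      G-step-inv : ∀ f {a u} → Step (app (inj₁ f) (xs f)) a u →
                   Σ (Fin (nRules f)) λ r → Σ (Fin (nStep (f , r)) → CT) λ ys →
                   GPremises (f , r) ys × TrConcl (embC G X (conclOf (f , r))) a (env (xs f) ys) u
      G-step-inv f (r , ys , pT , pP , nT , nQ , tc) =
        r , ys , (λ { (pos (step j)) → pT j ; (pos (pred j)) → pP j ; (neg (nostep j)) → nT j ; (neg (nopred j)) → nQ j }) , tc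

      G-step : ∀ c {ys a u} → GPremises c ys → TrConcl (embC G X (conclOf c)) a (env (xs (proj₁ c)) ys) u →
               Step (app (inj₁ (proj₁ c)) (xs (proj₁ c))) a u
      G-step c ok tc =
        proj₂ c , _ , (λ j → ok (pos (step j))) , (λ j → ok (pos (pred j))) , (λ j → ok (neg (nostep j))) , (λ j → ok (neg (nopred j))) , tc

      G-holds-inv : ∀ f {P} → Holds P (app (inj₁ f) (xs f)) →
                    Σ (Fin (nRules f)) λ r → Σ (Fin (nStep (f , r)) → CT) λ ys →
                    GPremises (f , r) ys × PrConcl (embC G X (conclOf (f , r))) P
      G-holds-inv f (r , ys , pT , pP , nT , nQ , pc) =
        r , ys , (λ { (pos (step j)) → pT j ; (pos (pred j)) → pP j ; (neg (nostep j)) → nT j ; (neg (nopred j)) → nQ j }) , pc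

      G-holds : ∀ c {ys P} → GPremises c ys → PrConcl (embC G X (conclOf c)) P →
                Holds P (app (inj₁ (proj₁ c)) (xs (proj₁ c)))
      G-holds c ok pc =
        proj₂ c , _ , (λ j → ok (pos (step j))) , (λ j → ok (pos (pred j))) , (λ j → ok (neg (nostep j))) , (λ j → ok (neg (nopred j))) , pc

      summand∈ : ∀ c → summand (ruleIndex c) ∈ map summand (rulesFor (proj₁ c))
      summand∈ c = ∈-map⁺ summand (∈-filter⁺ (λ g → proj₁ (ruleAt g) ≟F proj₁ c) (∈-allFin _)
                                              (≡.cong proj₁ (ruleAt-ruleIndex c)))

      summand-of : ∀ {f t} → t ∈ map summand (rulesFor f) → Σ (Fin ruleCount) λ g → proj₁ (ruleAt g) ≡ f × t ≡ summand g
      summand-of {f} t∈ = let (g , g∈ , t≡) = ∈-map⁻ summand t∈ in g , proj₂ (∈-filter⁻ (λ g → proj₁ (ruleAt g) ≟F f) {xs = allFin ruleCount} g∈) , t≡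

      summand-step : ∀ c {a u} → FStep c (copies c) a u → Step (summand (ruleIndex c) [ σ ]) a u
      summand-step c {a} {u} fs =
        F-step (ruleIndex c) (copies (ruleAt (ruleIndex c))) (≡.subst (λ c′ → FStep c′ (copies c′) a u) (≡.sym (ruleAt-ruleIndex c)) fs)

      summand-holds : ∀ c {P} → FHolds c (copies c) P → Holds P (summand (ruleIndex c) [ σ ])
      summand-holds c {P} fh =
        F-holds (ruleIndex c) (copies (ruleAt (ruleIndex c))) (≡.subst (λ c′ → FHolds c′ (copies c′) P) (≡.sym (ruleAt-ruleIndex c)) fh)

      expand-forth : ∀ f {a u} → Step (app (inj₁ f) (xs f)) a u → Step (expansion f [ σ ]) a u
      expand-forth f st =
        let (r , ys , ok , tc) = G-step-inv f st
        in sum-step (summand∈ (f , r)) (summand-step (f , r) (ys , premises-copies (f , r) ok , concl-copies (f , r) tc))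

      expand-back : ∀ f {a u} → Step (expansion f [ σ ]) a u → Step (app (inj₁ f) (xs f)) a u
      expand-back f {a} {u} st with sum-step-inv (map summand (rulesFor f)) st
      ... | t , t∈ , st′ with summand-of t∈
      ...   | g , op≡f , refl =
        let (ys , ok , tc) = F-step-inv g (copies (ruleAt g)) st′
        in ≡.subst (λ f′ → Step (app (inj₁ f′) (xs f′)) a u) op≡f
                   (G-step (ruleAt g) (copies-premises (ruleAt g) ok) (copies-concl (ruleAt g) tc))

      expand-holds-forth : ∀ f {P} → Holds P (app (inj₁ f) (xs f)) → Holds P (expansion f [ σ ])
      expand-holds-forth f h =
        let (r , ys , ok , pc) = G-holds-inv f h
        in sum-holds (summand∈ (f , r))
             (summand-holds (f , r) (ys , premises-copies (f , r) ok , ≡.subst id (≡.sym (FConcl-pred (conclOf (f , r)))) pc))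

      expand-holds-back : ∀ f {P} → Holds P (expansion f [ σ ]) → Holds P (app (inj₁ f) (xs f))
      expand-holds-back f {P} h with sum-holds-inv (map summand (rulesFor f)) h
      ... | t , t∈ , h′ with summand-of t∈
      ...   | g , op≡f , refl =
        let (ys , ok , pc) = F-holds-inv g (copies (ruleAt g)) h′
        in ≡.subst (λ f′ → Holds P (app (inj₁ f′) (xs f′))) op≡f
                   (G-holds (ruleAt g) (copies-premises (ruleAt g) ok) (≡.subst id (FConcl-pred (conclOf (ruleAt g))) pc))

    axiom-⇄ : (n : AxiomName) → (proj₁ (axiomEqn n) [ σ ]) ⇄ (proj₂ (axiomEqn n) [ σ ])
    axiom-⇄ assoc = ⇄-resp (≈-trans (⊕-inst _ _ σ) (⊕-≈ (⊕-inst _ _ σ) (≈-refl _))) (assoc-⇄ _ _ _)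
                           (≈-trans (⊕-inst _ _ σ) (⊕-≈ (≈-refl _) (⊕-inst _ _ σ)))
    axiom-⇄ unitˡ = ⇄-resp (≈-trans (⊕-inst _ _ σ) (⊕-≈ (δ-inst σ) (≈-refl _))) (unitˡ-⇄ _) (≈-refl _)
    axiom-⇄ unitʳ = ⇄-resp (≈-trans (⊕-inst _ _ σ) (⊕-≈ (≈-refl _) (δ-inst σ))) (unitʳ-⇄ _) (≈-refl _)
    axiom-⇄ (expand f) = mirror-⇄ (Expand.expand-forth f) (Expand.expand-back f)
                                  (Expand.expand-holds-forth f) (Expand.expand-holds-back f)
    axiom-⇄ (posAx g p k) = pos-⇄ g p k
    axiom-⇄ (negAx g n k) = neg-⇄ g n k
    axiom-⇄ (fire g) = Fire.fire-⇄ g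

  E-sound : Semantics.Sound (G' G X noImplicit) E
  E-sound = sound-by-transfer (λ k σ → AxiomSoundness.axiom-⇄ σ (Listing.nth axiomNames k))

  infix 4 _≐ₑ_
  record _≐ₑ_ (t u : CT) : Set where
    constructor derived
    field derivation : E ⊢ close t ≐ close u
  open _≐ₑ_

  ≐-refl : ∀ {t} → t ≐ₑ t
  ≐-refl = derived (refl _)

  ≐-sym : ∀ {t u} → t ≐ₑ u → u ≐ₑ t
  ≐-sym (derived d) = derived (sym d)

  ≐-trans : ∀ {t u v} → t ≐ₑ u → u ≐ₑ v → t ≐ₑ v
  ≐-trans (derived d) (derived d') = derived (trans d d')

  ≈⇒≐ : {t u : CT} → t ≈ₜ u → t ≐ₑ u
  ≈⇒≐ e = derived (≈⇒⊢ E (≈-subst (λ ()) e))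

  ≡⇒≐ : {t u : CT} → t ≡ u → t ≐ₑ u
  ≡⇒≐ refl = ≐-refl

  axiom-inst : ∀ n (σ : ℕ → CT) → (proj₁ (axiomEqn n) [ σ ]) ≐ₑ (proj₂ (axiomEqn n) [ σ ])
  axiom-inst n σ = derived
    (trans (≈⇒⊢ E (subst-comp (proj₁ (axiomEqn n)) σ (λ ())))
           (trans (subst (λ v → close (σ v)) (useAxiom axiomNames axiomEqn n))
                  (≈⇒⊢ E (≈-sym (subst-comp (proj₂ (axiomEqn n)) σ (λ ()))))))

  ≐-⊕ : ∀ {x x' y y'} → x ≐ₑ x' → y ≐ₑ y' → (x ⊕ y) ≐ₑ (x' ⊕ y')
  ≐-⊕ (derived d) (derived d') = derived (cong (plus' G X) _ _ (λ { zero → d ; (suc zero) → d' }))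

  ≐-F : ∀ g {ts us} → (∀ k → ts k ≐ₑ us k) → F g ts ≐ₑ F g us
  ≐-F g ds = derived (cong (inj₂ (inj₂ g)) _ _ (λ k → derivation (ds k)))

  σ₃ : CT → CT → CT → ℕ → CT
  σ₃ x y z 0 = x
  σ₃ x y z 1 = y
  σ₃ x y z _ = z

  assoc≐ : ∀ x y z → ((x ⊕ y) ⊕ z) ≐ₑ (x ⊕ (y ⊕ z))
  assoc≐ x y z =
    ≐-trans (≈⇒≐ (≈-sym (≈-trans (⊕-inst _ _ σ) (⊕-≈ (⊕-inst _ _ σ) (≈-refl _)))))
          (≐-trans (axiom-inst assoc σ) (≈⇒≐ (≈-trans (⊕-inst _ _ σ) (⊕-≈ (≈-refl _) (⊕-inst _ _ σ)))))
    where
    σ : ℕ → CT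
    σ = σ₃ x y z

  unitˡ≐ : ∀ x → (δₜ ⊕ x) ≐ₑ x
  unitˡ≐ x = ≐-trans (≈⇒≐ (≈-sym (≈-trans (⊕-inst _ _ σ) (⊕-≈ (δ-inst σ) (≈-refl _))))) (axiom-inst unitˡ σ)
    where
    σ : ℕ → CT
    σ = σ₃ x x x

  unitʳ≐ : ∀ x → (x ⊕ δₜ) ≐ₑ x
  unitʳ≐ x = ≐-trans (≈⇒≐ (≈-sym (≈-trans (⊕-inst _ _ σ) (⊕-≈ (≈-refl _) (δ-inst σ))))) (axiom-inst unitʳ σ)
    where
    σ : ℕ → CT
    σ = σ₃ x x x

  SumForm : CT → Set
  SumForm u = IsDelta G X u ⊎ IsSum G X u

  Summable : CT → Set
  Summable t = Σ CT λ u → SumForm u × t ≐ₑ u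

  summable-≐ : ∀ {t t'} → t ≐ₑ t' → Summable t' → Summable t
  summable-≐ d (u , form , d') = u , form , ≐-trans d d'

  δ-summable : ∀ {t} → t ≐ₑ δₜ → Summable t
  δ-summable d = δₜ , inj₁ refl , d

  δ≈ : {ts : Fin 0 → CT} → app (δ' G X) ts ≈ₜ δₜ
  δ≈ = app≈ _ _ _ (λ ())

  ⊕-summable : ∀ {x y} → Summable x → Summable y → Summable (x ⊕ y)
  ⊕-summable (var () , _) _
  ⊕-summable _ (var () , _)
  ⊕-summable (app _ ts , inj₁ refl , d) (u , form , d') = u , form , ≐-trans (≐-⊕ d d') (≐-trans (≐-⊕ (≈⇒≐ (δ≈ {ts})) ≐-refl) (unitˡ≐ u))
  ⊕-summable (u , inj₂ s , d) (app _ ts , inj₁ refl , d') = u , inj₂ s , ≐-trans (≐-⊕ d d') (≐-trans (≐-⊕ ≐-refl (≈⇒≐ (δ≈ {ts}))) (unitʳ≐ u))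
  ⊕-summable (u , inj₂ s , d) (u' , inj₂ s' , d') = u ⊕ u' , inj₂ (sPlus (pair u u') s s') , ≐-⊕ d d'

  data Atom : Set where
    prefixAtom : Act → CT → Atom
    predAtom   : Pred → Atom

  atomₜ : Atom → CT
  atomₜ (prefixAtom a t) = a · t
  atomₜ (predAtom Q) = κₜ Q

  sumOf : List Atom → CT
  sumOf [] = δₜ
  sumOf (x ∷ l) = atomₜ x ⊕ sumOf l

  sumOf-++ : ∀ l₁ l₂ → (sumOf l₁ ⊕ sumOf l₂) ≐ₑ sumOf (l₁ ++ l₂)
  sumOf-++ [] l₂ = unitˡ≐ (sumOf l₂)
  sumOf-++ (x ∷ l₁) l₂ = ≐-trans (assoc≐ (atomₜ x) (sumOf l₁) (sumOf l₂)) (≐-⊕ ≐-refl (sumOf-++ l₁ l₂))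

  flatten : ∀ {u} → SumForm u → Σ (List Atom) λ l → u ≐ₑ sumOf l
  flatten {var ()} _
  flatten {app _ ts} (inj₁ refl) = [] , ≈⇒≐ (δ≈ {ts})
  flatten (inj₂ (sPre a ts)) =
    prefixAtom a (ts zero) ∷ [] , ≐-trans (≈⇒≐ (app≈ _ ts (λ _ → ts zero) (λ { zero → ≈-refl _ }))) (≐-sym (unitʳ≐ (a · ts zero)))
  flatten (inj₂ (sκ Q ts)) = predAtom Q ∷ [] , ≐-trans (≈⇒≐ (app≈ _ ts (λ ()) (λ ()))) (≐-sym (unitʳ≐ (κₜ Q)))
  flatten (inj₂ (sPlus ts s₁ s₂)) =
    let (l₁ , d₁) = flatten (inj₂ s₁) ; (l₂ , d₂) = flatten (inj₂ s₂)
    in l₁ ++ l₂ , ≐-trans (≈⇒≐ (app≈ _ ts (pair (ts zero) (ts (suc zero))) (λ { zero → ≈-refl _ ; (suc zero) → ≈-refl _ })))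
                        (≐-trans (≐-⊕ d₁ d₂) (sumOf-++ l₁ l₂))

  -- Normalizing F_g(ts): the arguments in the slots are brought to sums of
  -- atoms; the slots are then emptied one by one with the premise axioms
  -- until every slot holds a good argument, where the fire axiom applies.
  module NormF (g : Fin ruleCount) where

    c : Code
    c = ruleAt g

    Good : Slot c → CT → Set
    Good (pos (step j)) t = Σ CT λ y → t ≡ stepAct j · y
    Good (pos (pred j)) t = t ≡ κₜ (predOf j)
    Good (neg _) t = t ≡ δₜ

    Cont : Slot c → (Fin (arC c) → CT) → Set
    Cont s cur = ∀ v → Good s v → Summable (F g (cur ⟨ slotPos s ≔ v ⟩))

    σat : (Fin (arC c) → CT) → Slot c → CT → CT → ℕ → CT
    σat cur s x y = envℕ (cur ⟨ slotPos s ≔ x ⟩) y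

    σat-slot : ∀ cur s x y → (slotVar s [ σat cur s x y ]) ≡ x
    σat-slot cur s x y = ≡.trans (envℕ-at (cur ⟨ slotPos s ≔ x ⟩) y (slotPos s)) (≔-same cur (slotPos s) x)

    σat-fresh : ∀ cur s x y → (fresh c [ σat cur s x y ]) ≡ y
    σat-fresh cur s x y = envℕ-beyond (arC c) (cur ⟨ slotPos s ≔ x ⟩) y

    Fslot-at : ∀ cur s x y T {t} → (T [ σat cur s x y ]) ≈ₜ t → (Fslot g s T [ σat cur s x y ]) ≈ₜ F g (cur ⟨ slotPos s ≔ t ⟩)
    Fslot-at cur s x y T {t} e =
      ≈-trans (AxiomSoundness.Fslot-inst (σat cur s x y) g s T e)
              (app≈ _ _ _ (λ k → ≡⇒≈ (≡.trans (≔-resp (slotPos s) t (envℕ-at (cur ⟨ slotPos s ≔ x ⟩) y) k)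
                                               (≔-≔ cur (slotPos s) x t k))))

    pos-axiom : ∀ p k cur x y → F g (cur ⟨ slotPos (pos p) ≔ posShape k x y ⟩) ≐ₑ (posRHS g p k [ σat cur (pos p) x y ])
    pos-axiom p k cur x y =
      ≐-trans (≈⇒≐ (≈-sym (Fslot-at cur (pos p) x y _
                   (≈-trans (posShape-inst k _ _ _) (≡⇒≈ (≡.cong₂ (posShape k) (σat-slot cur (pos p) x y) (σat-fresh cur (pos p) x y)))))))
            (axiom-inst (posAx g p k) (σat cur (pos p) x y))

    neg-axiom : ∀ n k cur x y → F g (cur ⟨ slotPos (neg n) ≔ negShape k x y ⟩) ≐ₑ (negRHS g n k [ σat cur (neg n) x y ])
    neg-axiom n k cur x y =
      ≐-trans (≈⇒≐ (≈-sym (Fslot-at cur (neg n) x y _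
                   (≈-trans (negShape-inst k _ _ _) (≡⇒≈ (≡.cong₂ (negShape k) (σat-slot cur (neg n) x y) (σat-fresh cur (neg n) x y)))))))
            (axiom-inst (negAx g n k) (σat cur (neg n) x y))

    pos-killed : ∀ p k cur x y → posRHS g p k ≡ δₜ → F g (cur ⟨ slotPos (pos p) ≔ posShape k x y ⟩) ≐ₑ δₜ
    pos-killed p k cur x y rhs≡δ = ≐-trans (pos-axiom p k cur x y) (≐-trans (≡⇒≐ (≡.cong (_[ _ ]) rhs≡δ)) (≈⇒≐ (δ-inst _)))

    pos-split : ∀ p cur x y → F g (cur ⟨ slotPos (pos p) ≔ x ⊕ y ⟩) ≐ₑ (F g (cur ⟨ slotPos (pos p) ≔ x ⟩) ⊕ F g (cur ⟨ slotPos (pos p) ≔ y ⟩))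
    pos-split p cur x y =
      ≐-trans (pos-axiom p sum cur x y)
            (≈⇒≐ (≈-trans (⊕-inst _ _ _) (⊕-≈ (Fslot-at cur (pos p) x y _ (≡⇒≈ (σat-slot cur (pos p) x y)))
                                               (Fslot-at cur (pos p) x y _ (≡⇒≈ (σat-fresh cur (pos p) x y))))))

    neg-killed : ∀ n k cur x y → negRHS g n k ≡ δₜ → F g (cur ⟨ slotPos (neg n) ≔ negShape k x y ⟩) ≐ₑ δₜ
    neg-killed n k cur x y rhs≡δ = ≐-trans (neg-axiom n k cur x y) (≐-trans (≡⇒≐ (≡.cong (_[ _ ]) rhs≡δ)) (≈⇒≐ (δ-inst _)))

    neg-dropped : ∀ n k cur x y → negRHS g n k ≡ Fslot g (neg n) (fresh c) →
                  F g (cur ⟨ slotPos (neg n) ≔ negShape k x y ⟩) ≐ₑ F g (cur ⟨ slotPos (neg n) ≔ y ⟩)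
    neg-dropped n k cur x y rhs≡ =
      ≐-trans (neg-axiom n k cur x y)
            (≐-trans (≡⇒≐ (≡.cong (_[ _ ]) rhs≡)) (≈⇒≐ (Fslot-at cur (neg n) x y _ (≡⇒≈ (σat-fresh cur (neg n) x y)))))

    self : ∀ cur s {v} → cur (slotPos s) ≡ v → F g cur ≐ₑ F g (cur ⟨ slotPos s ≔ v ⟩)
    self cur s refl = ≈⇒≐ (app≈ _ _ _ (λ k → ≡⇒≈ (≡.sym (≔-self cur (slotPos s) k))))

    shift : ∀ {cur} s t → Cont s cur → Cont s (cur ⟨ slotPos s ≔ t ⟩)
    shift {cur} s t k v good = summable-≐ (≈⇒≐ (app≈ _ _ _ (λ i → ≡⇒≈ (≔-≔ cur (slotPos s) t v i)))) (k v good)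

    posAtom : ∀ p cur (x : Atom) → Cont (pos p) cur → Summable (F g (cur ⟨ slotPos (pos p) ≔ atomₜ x ⟩))
    posAtom (step j) cur (prefixAtom a t) k with a ≟F stepAct j
    ... | yes refl = k (a · t) (t , refl)
    ... | no a≢ = δ-summable (pos-killed (step j) (act a) cur t δₜ (when-δ (a ≟F stepAct j) a≢))
    posAtom (pred j) cur (prefixAtom a t) k = δ-summable (pos-killed (pred j) (act a) cur t δₜ refl)
    posAtom (step j) cur (predAtom Q) k = δ-summable (pos-killed (step j) (con Q) cur δₜ δₜ refl)
    posAtom (pred j) cur (predAtom Q) k with Q ≟F predOf j
    ... | yes refl = k (κₜ Q) refl
    ... | no Q≢ = δ-summable (pos-killed (pred j) (con Q) cur δₜ δₜ (when-δ (Q ≟F predOf j) Q≢))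

    posSlot : ∀ p l cur → cur (slotPos (pos p)) ≡ sumOf l → Cont (pos p) cur → Summable (F g cur)
    posSlot p [] cur e k = δ-summable (≐-trans (self cur (pos p) e) (pos-killed p nil cur δₜ δₜ refl))
    posSlot p (x ∷ l) cur e k =
      summable-≐ (≐-trans (self cur (pos p) e) (pos-split p cur (atomₜ x) (sumOf l)))
                 (⊕-summable (posAtom p cur x k)
                             (posSlot p l (cur ⟨ s ≔ sumOf l ⟩) (≔-same cur s (sumOf l)) (shift (pos p) (sumOf l) k)))
      where
      s : Fin (arC c)
      s = slotPos (pos p)

    negAtom : ∀ n k → (negRHS g n k ≡ δₜ) ⊎ (negRHS g n k ≡ Fslot g (neg n) (fresh c))
    negAtom (nostep j) (act+ a) with a ≟F noStepAct j
    ... | yes _ = inj₁ refl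
    ... | no _ = inj₂ refl
    negAtom (nostep j) (con+ Q) = inj₂ refl
    negAtom (nopred j) (act+ a) = inj₂ refl
    negAtom (nopred j) (con+ Q) with Q ≟F noPredOf j
    ... | yes _ = inj₁ refl
    ... | no _ = inj₂ refl

    negSlot : ∀ n l cur → cur (slotPos (neg n)) ≡ sumOf l → Cont (neg n) cur → Summable (F g cur)
    negSlot n [] cur e k = summable-≐ (self cur (neg n) e) (k δₜ refl)
    negSlot n (x ∷ l) cur e k = [ killed , dropped ]′ (negAtom n (shape x))
      where
      s : Fin (arC c)
      s = slotPos (neg n)
      shape : Atom → NegShape
      shape (prefixAtom a t) = act+ a
      shape (predAtom Q) = con+ Q
      head : Atom → CT
      head (prefixAtom a t) = t
      head (predAtom Q) = δₜ
      as-shape : ∀ x → atomₜ x ⊕ sumOf l ≡ negShape (shape x) (head x) (sumOf l)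
      as-shape (prefixAtom a t) = refl
      as-shape (predAtom Q) = refl
      unfold : F g cur ≐ₑ F g (cur ⟨ s ≔ negShape (shape x) (head x) (sumOf l) ⟩)
      unfold = self cur (neg n) (≡.trans e (as-shape x))
      killed : negRHS g n (shape x) ≡ δₜ → Summable (F g cur)
      killed rhs≡δ = δ-summable (≐-trans unfold (neg-killed n (shape x) cur (head x) (sumOf l) rhs≡δ))
      dropped : negRHS g n (shape x) ≡ Fslot g (neg n) (fresh c) → Summable (F g cur)
      dropped rhs≡ = summable-≐ (≐-trans unfold (neg-dropped n (shape x) cur (head x) (sumOf l) rhs≡))
                                (negSlot n l (cur ⟨ s ≔ sumOf l ⟩) (≔-same cur s (sumOf l)) (shift (neg n) (sumOf l) k))

    fire-step : ∀ cur → (∀ s → Good s (cur (slotPos s))) → Summable (F g cur)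
    fire-step cur good =
      fireRHS c (conclOf c) [ σ ] , fire-form (conclOf c) ,
      ≐-trans (≐-F g (λ k → ≈⇒≐ (≈-sym (fire-inst k)))) (axiom-inst (fire g) σ)
      where
      pick : Fin (arC c) → Arg c → CT
      pick k (prem (pos (step j))) = proj₁ (good (pos (step j)))
      pick k _ = cur k
      σ : ℕ → CT
      σ = envℕ (λ k → pick k (argView k)) δₜ
      σ-slot : ∀ s → σ (toℕ (slotPos s)) ≡ pick (slotPos s) (prem s)
      σ-slot s = ≡.trans (envℕ-at _ δₜ (slotPos s)) (≡.cong (pick (slotPos s)) (view-slotPos s))
      fire-inst : ∀ k → (goodAt (argView k) [ σ ]) ≈ₜ cur k
      fire-inst k with argView k in eq
      ... | orig i = ≡⇒≈ (≡.trans (envℕ-at _ δₜ (origPos i))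
                           (≡.trans (≡.cong (pick (origPos i)) (view-origPos i)) (≡.cong cur (≡.sym (view⇒encode eq)))))
      ... | prem s@(pos (step j)) =
            ≡⇒≈ (≡.trans (≡.cong (stepAct j ·_) (σ-slot s)) (≡.trans (≡.sym (proj₂ (good s))) (≡.cong cur (≡.sym (view⇒encode eq)))))
      ... | prem s@(pos (pred j)) = ≈-trans (κ-inst _ σ) (≡⇒≈ (≡.trans (≡.sym (good s)) (≡.cong cur (≡.sym (view⇒encode eq)))))
      ... | prem s@(neg (nostep j)) = ≈-trans (δ-inst σ) (≡⇒≈ (≡.trans (≡.sym (good s)) (≡.cong cur (≡.sym (view⇒encode eq)))))
      ... | prem s@(neg (nopred j)) = ≈-trans (δ-inst σ) (≡⇒≈ (≡.trans (≡.sym (good s)) (≡.cong cur (≡.sym (view⇒encode eq)))))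
      fire-form : ∀ cc′ → SumForm (fireRHS c cc′ [ σ ])
      fire-form (transC a C) = inj₂ (sPre a _)
      fire-form (predC Q) = inj₂ (sκ Q _)

    Stage : List (Slot c) → (Fin (arC c) → CT) → Set
    Stage rem cur = ∀ s → (s ∈ rem × Σ (List Atom) λ l → cur (slotPos s) ≡ sumOf l) ⊎ Good s (cur (slotPos s))

    process : ∀ rem cur → Stage rem cur → Summable (F g cur)
    process [] cur stage = fire-step cur (λ s → [ (λ { (() , _) }) , id ]′ (stage s))
    process (s ∷ rem) cur stage with stage s
    ... | inj₂ good = process rem cur (λ s′ → settled s′ (stage s′))
      where
      settled : ∀ s′ → (s′ ∈ s ∷ rem × Σ (List Atom) λ l → cur (slotPos s′) ≡ sumOf l) ⊎ Good s′ (cur (slotPos s′)) →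
                (s′ ∈ rem × Σ (List Atom) λ l → cur (slotPos s′) ≡ sumOf l) ⊎ Good s′ (cur (slotPos s′))
      settled s′ (inj₁ (here refl , _)) = inj₂ good
      settled s′ (inj₁ (there s′∈ , l)) = inj₁ (s′∈ , l)
      settled s′ (inj₂ good′) = inj₂ good′
    ... | inj₁ (_ , l , e) = slot s l cur e (λ v good → process rem (cur ⟨ slotPos s ≔ v ⟩) (advance v good))
      where
      slot : ∀ s l cur → cur (slotPos s) ≡ sumOf l → Cont s cur → Summable (F g cur)
      slot (pos p) = posSlot p
      slot (neg n) = negSlot n
      advance : ∀ v → Good s v → Stage rem (cur ⟨ slotPos s ≔ v ⟩)
      advance v good s′ with s′ ≟S s
      ... | yes refl = inj₂ (≡.subst (Good s) (≡.sym (≔-same cur (slotPos s) v)) good)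
      ... | no s′≢s = [ (λ { (here s′≡s , _) → ⊥-elim (s′≢s s′≡s)
                           ; (there s′∈ , l′ , e′) → inj₁ (s′∈ , l′ , ≡.trans unchanged e′) })
                      , (λ good′ → inj₂ (≡.subst (Good s′) (≡.sym unchanged) good′)) ]′ (stage s′)
        where
        unchanged : (cur ⟨ slotPos s ≔ v ⟩) (slotPos s′) ≡ cur (slotPos s′)
        unchanged = ≔-other cur v (slotPos-injective s′≢s)

    normF : ∀ ts → (∀ k → Summable (ts k)) → Summable (F g ts)
    normF ts normal =
      summable-≐ (≐-F g (λ k → proj₂ (flat k)))
                 (process (Listing.list slots) cur (λ s → inj₁ (Listing.complete slots s , proj₁ (flat (slotPos s)) , refl)))
      where
      flat : ∀ k → Σ (List Atom) λ l → ts k ≐ₑ sumOf l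
      flat k = let (u , form , d) = normal k ; (l , d′) = flatten form in l , ≐-trans d d′
      cur : Fin (arC c) → CT
      cur k = sumOf (proj₁ (flat k))
      slots : Listing (Slot c)
      slots = (listFin _ ⊎ˡ listFin _) ⊎ˡ (listFin _ ⊎ˡ listFin _)

  envℕ-summable : ∀ {n} (ts : Fin n → CT) → (∀ i → Summable (ts i)) → ∀ k → Summable (envℕ ts δₜ k)
  envℕ-summable {zero} ts normal k = δ-summable ≐-refl
  envℕ-summable {suc n} ts normal zero = normal zero
  envℕ-summable {suc n} ts normal (suc k) = envℕ-summable (λ i → ts (suc i)) (λ i → normal (suc i)) k

  sum-summable : ∀ (ts : List (Term SX ℕ)) σ → (∀ t → t ∈ ts → Summable (t [ σ ])) → Summable (sumₜ ts [ σ ])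
  sum-summable [] σ _ = δ-summable (≈⇒≐ (δ-inst σ))
  sum-summable (t ∷ ts) σ normal =
    summable-≐ (≈⇒≐ (⊕-inst t (sumₜ ts) σ))
               (⊕-summable (normal t (here refl)) (sum-summable ts σ (λ t′ t′∈ → normal t′ (there t′∈))))

  expand-summable : ∀ f ts → (∀ i → Summable (ts i)) → Summable (app (inj₁ f) ts)
  expand-summable f ts normal = summable-≐ (≐-trans (≈⇒≐ as-instance) (axiom-inst (expand f) σ)) (sum-summable _ σ summands)
    where
    σ : ℕ → CT
    σ = envℕ ts δₜ
    as-instance : app (inj₁ f) ts ≈ₜ (app (inj₁ f) (λ i → var (toℕ i)) [ σ ])
    as-instance = app≈ _ _ _ (λ i → ≡⇒≈ (≡.sym (envℕ-at ts δₜ i)))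
    summands : ∀ t → t ∈ map summand (rulesFor f) → Summable (t [ σ ])
    summands t t∈ with ∈-map⁻ summand t∈
    ... | g , _ , refl = NormF.normF g _ (λ k → copy (argView k))
      where
      copy : (a : Arg (ruleAt g)) → Summable (expandAt a [ σ ])
      copy (orig i) = envℕ-summable ts normal (toℕ i)
      copy (prem s) = envℕ-summable ts normal (toℕ (tested s))

  normalize : (t : CT) → Summable t
  normalize (var ())
  normalize (app (inj₁ f) ts) = expand-summable f ts (λ i → normalize (ts i))
  normalize (app (inj₂ (inj₁ δ)) ts) = _ , inj₁ refl , ≐-refl
  normalize (app (inj₂ (inj₁ (κ Q))) ts) = _ , inj₂ (sκ Q ts) , ≐-refl
  normalize (app (inj₂ (inj₁ (pre a))) ts) = _ , inj₂ (sPre a ts) , ≐-refl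
  normalize (app (inj₂ (inj₁ plus)) ts) =
    summable-≐ (≈⇒≐ (app≈ _ ts (pair (ts zero) (ts (suc zero))) (λ { zero → ≈-refl _ ; (suc zero) → ≈-refl _ })))
               (⊕-summable (normalize (ts zero)) (normalize (ts (suc zero))))
  normalize (app (inj₂ (inj₂ g)) ts) = NormF.normF g ts (λ k → normalize (ts k))

  sum-preds : ∀ {u} → SumForm u → (∀ P → Holds P u → KappaIn G X P u) × (∀ P → KappaIn G X P u → Holds P u)
  sum-preds {var ()} _
  sum-preds {app _ ts} (inj₁ refl) = (λ P → λ { (() , _) }) , (λ P ())
  sum-preds (inj₂ (sPre a ts)) = (λ P → λ { (inj₁ _ , _ , _ , _ , _ , _ , ()) ; (inj₂ (_ , ()) , _) }) , (λ P ())
  sum-preds (inj₂ (sκ Q ts)) =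
    (λ P → λ { (_ , _ , _ , _ , _ , _ , refl) → here ts })
    , (λ { P (here .ts) → _ , (λ ()) , (λ ()) , (λ ()) , (λ ()) , (λ ()) , refl })
  sum-preds (inj₂ (sPlus ts s₁ s₂)) =
    (λ P h → [ left ts ∘ proj₁ IH₁ P , right ts ∘ proj₁ IH₂ P ]′ (⊕-holds-inv ts h))
    , (λ { P (left .ts k) → ⊕-holdsˡ ts (proj₂ IH₁ P k) ; P (right .ts k) → ⊕-holdsʳ ts (proj₂ IH₂ P k) })
    where
    IH₁ : (∀ P → Holds P (ts zero) → KappaIn G X P (ts zero)) × (∀ P → KappaIn G X P (ts zero) → Holds P (ts zero))
    IH₁ = sum-preds (inj₂ s₁)
    IH₂ : (∀ P → Holds P (ts (suc zero)) → KappaIn G X P (ts (suc zero))) × (∀ P → KappaIn G X P (ts (suc zero)) → Holds P (ts (suc zero)))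
    IH₂ = sum-preds (inj₂ s₂)

  head-normalizing : HeadNormalizing G X noImplicit E
  head-normalizing t = let (u , form , derived d) = normalize t in u , (form , sum-preds form) , d

theorem20 : (nA nP : ℕ) → let open Preg nA nP in
    (G : PregSystem) →
      Σ (Pred → Bool) λ D → Σ (Extension G) λ X → Σ (AxiomSystem (S' G X)) λ E →
        Semantics.Sound (G' G X D) E × HeadNormalizing G X D E
theorem20 nA nP G = noImplicit , X , E , E-sound , head-normalizing
  where open Construction nA nP G
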